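{- Let $f(n)$ denote the minimum, over all tournaments $T_n$ on $n$ vertices, of the maximum number of pairwise edge-disjoint transitive triples contained in $T_n$. Then $f(n) > 0.13\,n^2(1+o(1))$; that is, there is a function $\varepsilon(n)\to 0$ as $n\to\infty$ such that $f(n) > 0.13\,n^2(1+\varepsilon(n))$ for all sufficiently large $n$.
   Context: A tournament on $n$ vertices is an orientation of the complete graph $K_n$: for every two distinct vertices $x,y$ exactly one of $(x,y)$, $(y,x)$ is an edge. A transitive triple ($TT_3$) is a set of three edges of the form $\{(x,y),(x,z),(y,z)\}$. Transitive triples are edge-disjoint if no directed edge belongs to two of them. -}

module Defs where

open import Data.Nat using (ℕ; suc; _+_; _*_; _∸_; _≤_)
open import Data.Fin using (Fin)
open import Data.Bool using (Bool; true; false)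
open import Data.Sum using (_⊎_)
open import Data.Product using (_×_; _,_; ∃-syntax)
open import Data.List using (List; []; _∷_; length; concatMap)
open import Data.List.Relation.Unary.All using (All)
open import Data.List.Relation.Unary.Unique.Propositional using (Unique)
open import Relation.Binary.PropositionalEquality using (_≡_; _≢_)

record Tournament (n : ℕ) : Set where
  field
    arc      : Fin n → Fin n → Bool
    loopless : ∀ x → arc x x ≡ false
    total    : ∀ x y → x ≢ y →
               (arc x y ≡ true × arc y x ≡ false) ⊎ (arc y x ≡ true × arc x y ≡ false)

open Tournament public

Edge : ℕ → Set
Edge n = Fin n × Fin n

Triple : ℕ → Set
Triple n = Fin n × Fin n × Fin n

IsTT3 : ∀ {n} → Tournament n → Triple n → Set
IsTT3 T (x , y , z) = arc T x y ≡ true × arc T x z ≡ true × arc T y z ≡ true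

edgesOf : ∀ {n} → Triple n → List (Edge n)
edgesOf (x , y , z) = (x , y) ∷ (x , z) ∷ (y , z) ∷ []

-- A list of transitive triples of T that are pairwise edge-disjoint:
-- every entry is a TT3 of T and no directed edge occurs twice among all their
-- edges (this also forbids listing the same triple twice).
EdgeDisjointTT3s : ∀ {n} → Tournament n → List (Triple n) → Set
EdgeDisjointTT3s T ts = All (IsTT3 T) ts × Unique (concatMap edgesOf ts)

module Submission where

-- Every tournament on seven points admits a Fano plane of whose seven lines at least (12 + t) / 7
-- are transitive, where t is its number of transitive triples; this finite fact is checked by a
-- branching search over orientations. Since at least 3/4 - o(1) of all triples are transitive, an
-- average seven-set yields (12 + 105/4) / 7 = 153/28 edge-disjoint transitive triples on its 21 pairs,
-- and 153/28 / 42 > 0.13.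
--
-- To use almost all pairs, write n = 7g + O(1) with g ≡ 1 (mod 60), split the vertices into seven
-- classes of size g, and take the g² transversals i ↦ a + i b + cᵢ (mod g): two points in different
-- classes lie on exactly one of them. Averaging over the partition and over the shifts c makes the
-- transversals behave like average seven-sets. The pairs inside a class are left to recursion,
-- which gives 13 n² ≤ 100 m + C n for a constant C.

open import Defs
open import Data.Bool using (Bool; true; false; not; if_then_else_; _∧_; T)
open import Data.Bool.ListAction using (any)
open import Data.Bool.Properties using (T-∧)
open import Data.Empty using (⊥; ⊥-elim)
open import Data.Fin using (Fin; zero; suc; toℕ; combine; inject≤; _↑ˡ_; _↑ʳ_)
import Data.Fin.Properties as Fin
open import Data.Fin.Properties
  using (toℕ-injective; toℕ-fromℕ<; toℕ<n; combine-injectiveˡ; combine-injectiveʳ)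
open import Data.List
  using (List; []; _∷_; _++_; length; concatMap; map; foldr; foldl; upTo; lookup; tabulate; allFin)
open import Data.List.Membership.Propositional using (_∈_; _∉_)
open import Data.List.Membership.Propositional.Properties using (∈-lookup; ∈-tabulate⁻)
open import Data.List.Properties
  using (concatMap-++; concatMap-map; map-concatMap; map-++; map-∘; map-cong; length-++; length-map; length-tabulate)
open import Data.List.Relation.Binary.Permutation.Propositional as ↭ using (_↭_; prep; swap; ↭-sym; ↭⇒↭ₛ)
open import Data.List.Relation.Binary.Permutation.Propositional.Properties using (map⁺; shift; ∈-resp-↭; ↭-length)
open import Data.List.Relation.Binary.Permutation.Setoid.Properties using (AllPairs-resp-↭)
open import Data.List.Relation.Unary.All as All using (All; []; _∷_)
import Data.List.Relation.Unary.All.Properties as All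
open import Data.List.Relation.Unary.AllPairs as AllPairs using (AllPairs; []; _∷_; allPairs?)
open import Data.List.Relation.Unary.Any as Any using (Any; here; there)
import Data.List.Relation.Unary.Any.Properties as Any
open import Data.List.Relation.Unary.Unique.Propositional using (Unique)
import Data.List.Relation.Unary.Unique.Propositional.Properties as Unique
open import Data.Nat
open import Data.Nat.DivMod
open import Data.Nat.Induction using (<-wellFounded; Acc; acc)
open import Data.Nat.ListAction using () renaming (sum to sumₗ)
open import Data.Nat.ListAction.Properties using (sum-↭) renaming (sum-++ to sumₗ-++)
open import Data.Nat.Properties
open import Data.Nat.Tactic.RingSolver using (solve-∀)
open import Data.Product using (_×_; _,_; ∃-syntax; ∃₂; proj₁; proj₂)
open import Data.Product.Properties using (≡-dec)
open import Data.Sum using (_⊎_; inj₁; inj₂)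
open import Data.Unit using (⊤; tt)
open import Data.Vec.Functional using () renaming (_∷_ to _∷ᶠ_)
open import Function using (_∘_; id; Equivalence)
open import Relation.Binary.Definitions using (tri<; tri≈; tri>)
open import Relation.Binary.PropositionalEquality hiding ([_])
open import Relation.Nullary using (Dec; yes; no; does)
open import Relation.Nullary.Decidable using (_×-dec_; ¬?; toWitness)
open import Relation.Unary using (Decidable)
open import Algebra.Properties.Semiring.Sum +-*-semiring
  using (sum; sum-syntax; sum-cong-≗; ∑-distrib-+; ∑-comm; *-distribˡ-sum)
open import Algebra.Properties.CommutativeSemigroup +-commutativeSemigroup using (interchange; xy∙z≈xz∙y)

-- A Fano plane chosen uniformly at random has t / 5 transitive lines on average, and t = 105/4
-- would then give only n² / 8, so the gain comes from picking a good plane for each block. In terms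
-- of the number d of cyclic triples, the search provides a plane with at most (d + 2) / 7 cyclic
-- lines: none for d ≤ 4, at most one for d ≤ 11, at most two up to the maximum d = 14. The bound is
-- stated linearly in t because only the average of t over the blocks is under control.
--
-- Transversals of seven classes are explicit: two points determine a and b once the index
-- differences 1, ..., 6 are invertible modulo g, which is where g ≡ 1 (mod 60) comes from. The
-- price is that about one seventh of all pairs lie inside classes, too many to discard. The
-- recursion must therefore reach the same density inside them, and the narrow margin of 153/1176 =
-- 0.1301... over 0.13 has to absorb the linear error of every level.
--
-- Expectations appear as sums over all choices with denominators cleared, so that the argument
-- stays within ℕ.

-- Finite sums and cyclic shifts

sum-mono : ∀ {n} {f g : Fin n → ℕ} → (∀ i → f i ≤ g i) → sum f ≤ sum g
sum-mono {zero}  f≤g = z≤n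
sum-mono {suc n} f≤g = +-mono-≤ (f≤g zero) (sum-mono (f≤g ∘ suc))

sum-const : ∀ n c → ∑[ _ < n ] c ≡ n * c
sum-const zero    c = refl
sum-const (suc n) c = cong (c +_) (sum-const n c)

∑³ : ∀ {n} → (Fin n → Fin n → Fin n → ℕ) → ℕ
∑³ {n} f = ∑[ x < n ] ∑[ y < n ] ∑[ z < n ] f x y z

∑³-cong : ∀ {n} {f h : Fin n → Fin n → Fin n → ℕ} → (∀ x y z → f x y z ≡ h x y z) → ∑³ f ≡ ∑³ h
∑³-cong {n} e = sum-cong-≗ {n} λ x → sum-cong-≗ {n} λ y → sum-cong-≗ {n} λ z → e x y z

∑³-mono : ∀ {n} {f h : Fin n → Fin n → Fin n → ℕ} → (∀ x y z → f x y z ≤ h x y z) → ∑³ f ≤ ∑³ h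
∑³-mono {n} le = sum-mono {n} λ x → sum-mono {n} λ y → sum-mono {n} λ z → le x y z

∑³-+ : ∀ {n} (f h : Fin n → Fin n → Fin n → ℕ) → ∑³ (λ x y z → f x y z + h x y z) ≡ ∑³ f + ∑³ h
∑³-+ {n} f h = trans
  (sum-cong-≗ {n} (λ x → trans (sum-cong-≗ {n} (λ y → ∑-distrib-+ {n} (f x y) (h x y)))
                               (∑-distrib-+ {n} _ _)))
  (∑-distrib-+ {n} _ _)

*-distribˡ-∑³ : ∀ {n} a (f : Fin n → Fin n → Fin n → ℕ) → a * ∑³ f ≡ ∑³ (λ x y z → a * f x y z)
*-distribˡ-∑³ {n} a f = trans (*-distribˡ-sum {n} a _) (sum-cong-≗ {n} λ x →
  trans (*-distribˡ-sum {n} a _) (sum-cong-≗ {n} λ y → *-distribˡ-sum {n} a (f x y)))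

sum-pigeonhole : ∀ n .{{_ : NonZero n}} c (f : Fin n → ℕ) →
                 n * c ≤ sum f → ∃[ i ] c ≤ f i
sum-pigeonhole (suc n) c f le with c ≤? f zero
sum-pigeonhole (suc n) c f le | yes c≤f0 = zero , c≤f0
sum-pigeonhole (suc zero) c f le | no c≰f0 =
  ⊥-elim (c≰f0 (subst₂ _≤_ (*-identityˡ c) (+-identityʳ (f zero)) le))
sum-pigeonhole (suc (suc n)) c f le | no c≰f0
  with sum-pigeonhole (suc n) c (f ∘ suc)
         (+-cancelˡ-≤ c _ _ (≤-trans le (+-monoˡ-≤ (sum (f ∘ suc)) (<⇒≤ (≰⇒> c≰f0)))))
... | i , c≤fi = suc i , c≤fi

sum-↑ : ∀ m n (f : Fin (m + n) → ℕ) →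
        sum f ≡ ∑[ i < m ] f (i ↑ˡ n) + ∑[ j < n ] f (m ↑ʳ j)
sum-↑ zero    n f = refl
sum-↑ (suc m) n f = trans (cong (f zero +_) (sum-↑ m n (f ∘ suc))) (sym (+-assoc (f zero) _ _))

sum-combine : ∀ m n (f : Fin (m * n) → ℕ) →
              sum f ≡ ∑[ x < m ] ∑[ p < n ] f (combine x p)
sum-combine zero    n f = refl
sum-combine (suc m) n f =
  trans (sum-↑ n (m * n) f) (cong (sum (λ p → f (p ↑ˡ (m * n))) +_) (sum-combine m n (f ∘ (n ↑ʳ_))))

toℕ-mod : ∀ {n} .{{_ : NonZero n}} (c : Fin n) → toℕ c mod n ≡ c
toℕ-mod c = toℕ-injective (trans (toℕ-fromℕ< _) (m<n⇒m%n≡m (toℕ<n c)))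

mod-cong : ∀ {x y} n .{{_ : NonZero n}} → x % n ≡ y % n → x mod n ≡ y mod n
mod-cong n eq = toℕ-injective (trans (toℕ-fromℕ< _) (trans eq (sym (toℕ-fromℕ< _))))

mod-injective : ∀ {x y} n .{{_ : NonZero n}} → x mod n ≡ y mod n → x % n ≡ y % n
mod-injective n eq = trans (sym (toℕ-fromℕ< _)) (trans (cong toℕ eq) (toℕ-fromℕ< _))

-- Both sides are f 0 + ... + f n. For periodic `f` the extra terms `f 0` and `f n` agree and
-- cancel, which is a shift by one.
sum-telescope : ∀ n (f : ℕ → ℕ) →
                ∑[ c < n ] f (suc (toℕ c)) + f 0 ≡ ∑[ c < n ] f (toℕ c) + f n
sum-telescope zero    f = refl
sum-telescope (suc n) f = begin
  (f 1 + s) + f 0        ≡⟨ shuffle (f 1) s (f 0) ⟩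
  f 0 + (s + f 1)        ≡⟨ cong (f 0 +_) (sum-telescope n (f ∘ suc)) ⟩
  f 0 + (s′ + f (suc n)) ≡⟨ sym (+-assoc (f 0) s′ _) ⟩
  f 0 + s′ + f (suc n)   ∎
  where
  open ≡-Reasoning
  s  = ∑[ c < n ] f (suc (suc (toℕ c)))
  s′ = ∑[ c < n ] f (suc (toℕ c))
  shuffle : ∀ a b c → (a + b) + c ≡ c + (b + a)
  shuffle = solve-∀

sum-periodic : ∀ n (f : ℕ → ℕ) → (∀ x → f (x + n) ≡ f x) →
               ∀ u → ∑[ c < n ] f (u + toℕ c) ≡ ∑[ c < n ] f (toℕ c)
sum-periodic n f per zero    = refl
sum-periodic n f per (suc u) = trans (sum-periodic n (f ∘ suc) (per ∘ suc) u)
  (+-cancelʳ-≡ (f 0) _ _ (trans (sum-telescope n f) (cong (sum (λ c → f (toℕ {n} c)) +_) (per 0))))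

-- Translation permutes the residues; extending `f` periodically to ℕ and shifting by one repeatedly
-- avoids constructing the bijection.
sum-shift : ∀ n .{{_ : NonZero n}} (f : Fin n → ℕ) →
            ∀ u → ∑[ c < n ] f ((u + toℕ c) mod n) ≡ sum f
sum-shift n f u = trans
  (sum-periodic n (λ x → f (x mod n)) (λ x → cong f (mod-cong n ([m+n]%n≡m%n x n))) u)
  (sum-cong-≗ {n} (λ c → cong f (toℕ-mod c)))

-- Averages over uniformly random maps

-- This is s ^ k times the expectation of `F` over a map with independent uniform values. Recursion
-- on the first value replaces an enumeration of the function space.
sumMaps : ∀ k {s} → ((Fin k → Fin s) → ℕ) → ℕ
sumMaps zero        F = F (λ ())
sumMaps (suc k) {s} F = ∑[ c < s ] sumMaps k (λ f → F (c ∷ᶠ f))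

sumMaps-pigeonhole : ∀ k s .{{_ : NonZero s}} c (F : (Fin k → Fin s) → ℕ) →
                     s ^ k * c ≤ sumMaps k F → ∃[ f ] c ≤ F f
sumMaps-pigeonhole zero    s c F le = (λ ()) , subst (_≤ F (λ ())) (*-identityˡ c) le
sumMaps-pigeonhole (suc k) s c F le
  with x , le′ ← sum-pigeonhole s (s ^ k * c) _ (≤-trans (≤-reflexive (sym (*-assoc s (s ^ k) c))) le)
  with f , le″ ← sumMaps-pigeonhole k s c _ le′ = (x ∷ᶠ f) , le″

sumMaps-cong : ∀ k {s} {F G : (Fin k → Fin s) → ℕ} → (∀ f → F f ≡ G f) → sumMaps k F ≡ sumMaps k G
sumMaps-cong zero        F≡G = F≡G _
sumMaps-cong (suc k) {s} F≡G = sum-cong-≗ {s} (λ c → sumMaps-cong k (λ f → F≡G (c ∷ᶠ f)))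

sumMaps-const : ∀ k s c → sumMaps k {s} (λ _ → c) ≡ s ^ k * c
sumMaps-const zero    s c = sym (*-identityˡ c)
sumMaps-const (suc k) s c = begin
  ∑[ _ < s ] sumMaps k {s} (λ _ → c) ≡⟨ sum-cong-≗ {s} (λ _ → sumMaps-const k s c) ⟩
  ∑[ _ < s ] (s ^ k * c)             ≡⟨ sum-const s _ ⟩
  s * (s ^ k * c)                   ≡⟨ sym (*-assoc s (s ^ k) c) ⟩
  s * s ^ k * c                     ∎
  where open ≡-Reasoning

sumMaps-sum : ∀ k {s} n (F : Fin n → (Fin k → Fin s) → ℕ) →
              sumMaps k (λ f → ∑[ i < n ] F i f) ≡ ∑[ i < n ] sumMaps k (F i)
sumMaps-sum zero        n F = refl
sumMaps-sum (suc k) {s} n F = trans (sum-cong-≗ {s} (λ c → sumMaps-sum k n (λ i f → F i (c ∷ᶠ f))))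
  (∑-comm {s} {n} (λ c i → sumMaps k (λ f → F i (c ∷ᶠ f))))

sumMaps-+ : ∀ k {s} (F G : (Fin k → Fin s) → ℕ) →
            sumMaps k (λ f → F f + G f) ≡ sumMaps k F + sumMaps k G
sumMaps-+ zero        F G = refl
sumMaps-+ (suc k) {s} F G = trans
  (sum-cong-≗ {s} (λ c → sumMaps-+ k (λ f → F (c ∷ᶠ f)) (λ f → G (c ∷ᶠ f))))
  (∑-distrib-+ {s} _ _)

sumMaps-* : ∀ k {s} a (F : (Fin k → Fin s) → ℕ) → a * sumMaps k F ≡ sumMaps k (λ f → a * F f)
sumMaps-* zero        a F = refl
sumMaps-* (suc k) {s} a F = trans (*-distribˡ-sum {s} a _)
  (sum-cong-≗ {s} (λ c → sumMaps-* k a (λ f → F (c ∷ᶠ f))))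

private
  conditional : ∀ {s} a (G H : Fin s → ℕ) p → (∀ c → a * G c ≡ p * H c) → s * a * sum G ≡ s * p * sum H
  conditional {s} a G H p eq = begin
    s * a * sum G              ≡⟨ *-assoc s a _ ⟩
    s * (a * sum G)            ≡⟨ cong (s *_) (*-distribˡ-sum {s} a G) ⟩
    s * ∑[ c < s ] (a * G c)    ≡⟨ cong (s *_) (sum-cong-≗ {s} eq) ⟩
    s * ∑[ c < s ] (p * H c)    ≡⟨ cong (s *_) (sym (*-distribˡ-sum {s} p H)) ⟩
    s * (p * sum H)            ≡⟨ sym (*-assoc s p _) ⟩
    s * p * sum H              ∎
    where open ≡-Reasoning

  -- Used when the summand ignores the first coordinate, which then contributes only a factor s.
  independent : ∀ {s} a p x y → a * x ≡ p * y → a * ∑[ _ < s ] x ≡ s * p * y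
  independent {s} a p x y eq = begin
    a * ∑[ _ < s ] x   ≡⟨ *-distribˡ-sum {s} a _ ⟩
    ∑[ _ < s ] (a * x)  ≡⟨ sum-const s _ ⟩
    s * (a * x)        ≡⟨ cong (s *_) eq ⟩
    s * (p * y)        ≡⟨ sym (*-assoc s p y) ⟩
    s * p * y          ∎
    where open ≡-Reasoning

-- Together with the next two lemmas: any one, two or three distinct coordinates of a random map are
-- uniform and independent. The powers of s on both sides are the cleared denominators.
sumMaps-marginal₁ : ∀ k s (i : Fin k) (G : Fin s → ℕ) →
                    s * sumMaps k (λ f → G (f i)) ≡ s ^ k * sum G
sumMaps-marginal₁ (suc k) s zero    G = begin
  s * ∑[ c < s ] sumMaps k {s} (λ _ → G c) ≡⟨ cong (s *_) (sum-cong-≗ {s} (λ c → sumMaps-const k s (G c))) ⟩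
  s * ∑[ c < s ] (s ^ k * G c)              ≡⟨ cong (s *_) (sym (*-distribˡ-sum {s} (s ^ k) G)) ⟩
  s * (s ^ k * sum G)                      ≡⟨ sym (*-assoc s (s ^ k) _) ⟩
  s * s ^ k * sum G                        ∎
  where open ≡-Reasoning
sumMaps-marginal₁ (suc k) s (suc i) G = independent {s} s (s ^ k) _ _ (sumMaps-marginal₁ k s i G)

sumMaps-marginal₂ : ∀ k s {i j : Fin k} → i ≢ j → (G : Fin s → Fin s → ℕ) →
                    s * s * sumMaps k (λ f → G (f i) (f j)) ≡ s ^ k * ∑[ x < s ] ∑[ y < s ] G x y
sumMaps-marginal₂ (suc k) s {zero}  {zero}  i≢j G = ⊥-elim (i≢j refl)
sumMaps-marginal₂ (suc k) s {zero}  {suc j} i≢j G =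
  conditional {s} s _ _ (s ^ k) (λ c → sumMaps-marginal₁ k s j (G c))
sumMaps-marginal₂ (suc k) s {suc i} {zero}  i≢j G =
  trans (conditional {s} s _ _ (s ^ k) (λ c → sumMaps-marginal₁ k s i (λ x → G x c)))
        (cong (s ^ suc k *_) (∑-comm {s} {s} (λ y x → G x y)))
sumMaps-marginal₂ (suc k) s {suc i} {suc j} i≢j G =
  independent {s} (s * s) (s ^ k) _ _ (sumMaps-marginal₂ k s (i≢j ∘ cong suc) G)

sumMaps-marginal₃ : ∀ k s {i j l : Fin k} → i ≢ j → i ≢ l → j ≢ l → (G : Fin s → Fin s → Fin s → ℕ) →
                    s * (s * s) * sumMaps k (λ f → G (f i) (f j) (f l)) ≡
                    s ^ k * ∑[ x < s ] ∑[ y < s ] ∑[ z < s ] G x y z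
sumMaps-marginal₃ (suc k) s {zero} {zero}  i≢j i≢l j≢l G = ⊥-elim (i≢j refl)
sumMaps-marginal₃ (suc k) s {zero} {suc j} {zero} i≢j i≢l j≢l G = ⊥-elim (i≢l refl)
sumMaps-marginal₃ (suc k) s {zero} {suc j} {suc l} i≢j i≢l j≢l G =
  conditional {s} (s * s) _ _ (s ^ k) (λ c → sumMaps-marginal₂ k s (j≢l ∘ cong suc) (G c))
sumMaps-marginal₃ (suc k) s {suc i} {zero} {zero} i≢j i≢l j≢l G = ⊥-elim (j≢l refl)
sumMaps-marginal₃ (suc k) s {suc i} {zero} {suc l} i≢j i≢l j≢l G =
  trans (conditional {s} (s * s) _ _ (s ^ k) (λ c → sumMaps-marginal₂ k s (i≢l ∘ cong suc) (λ x z → G x c z)))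
        (cong (s ^ suc k *_) (∑-comm {s} {s} (λ y x → ∑[ z < s ] G x y z)))
sumMaps-marginal₃ (suc k) s {suc i} {suc j} {zero} i≢j i≢l j≢l G =
  trans (conditional {s} (s * s) _ _ (s ^ k) (λ c → sumMaps-marginal₂ k s (i≢j ∘ cong suc) (λ x y → G x y c)))
        (cong (s ^ suc k *_) (trans (∑-comm {s} {s} (λ z x → ∑[ y < s ] G x y z))
                                    (sum-cong-≗ {s} (λ x → ∑-comm {s} {s} (λ z y → G x y z)))))
sumMaps-marginal₃ (suc k) s {suc i} {suc j} {suc l} i≢j i≢l j≢l G =
  independent {s} (s * (s * s)) (s ^ k) _ _
    (sumMaps-marginal₃ k s (i≢j ∘ cong suc) (i≢l ∘ cong suc) (j≢l ∘ cong suc) G)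

-- Counting transitive triples

δ : ∀ {n} → Fin n → Fin n → ℕ
δ zero    zero    = 1
δ zero    (suc y) = 0
δ (suc x) zero    = 0
δ (suc x) (suc y) = δ x y

δ-diagonal : ∀ {n} (x : Fin n) → δ x x ≡ 1
δ-diagonal zero    = refl
δ-diagonal (suc x) = δ-diagonal x

sum-δ : ∀ {n} (x : Fin n) → ∑[ y < n ] δ x y ≡ 1
sum-δ {suc n} zero    = cong suc (trans (sum-const n 0) (*-zeroʳ n))
sum-δ {suc n} (suc x) = sum-δ x

indicator : Bool → ℕ
indicator true  = 1
indicator false = 0

indicator≤1 : ∀ b → indicator b ≤ 1
indicator≤1 true  = ≤-refl
indicator≤1 false = z≤n

module _ {n : ℕ} (T : Tournament n) where

  adj : Fin n → Fin n → ℕ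
  adj x y = indicator (arc T x y)

  -- For distinct x, y, z this is 1 or 0 according as the triple is transitive or
  -- cyclic: the three summands look for the source of a transitive triple.
  transitivity : Fin n → Fin n → Fin n → ℕ
  transitivity x y z = adj x y * adj x z + adj y x * adj y z + adj z x * adj z y

  transitivity-swap₁₂ : ∀ x y z → transitivity x y z ≡ transitivity y x z
  transitivity-swap₁₂ x y z = solve (adj x y) (adj x z) (adj y x) (adj y z) (adj z x) (adj z y)
    where
    solve : ∀ a b c d e f → a * b + c * d + e * f ≡ c * d + a * b + f * e
    solve = solve-∀

  transitivity-swap₂₃ : ∀ x y z → transitivity x y z ≡ transitivity x z y
  transitivity-swap₂₃ x y z = solve (adj x y) (adj x z) (adj y x) (adj y z) (adj z x) (adj z y)
    where
    solve : ∀ a b c d e f → a * b + c * d + e * f ≡ b * a + e * f + c * d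
    solve = solve-∀

  -- Valid for repeated vertices as well. This crude bound serves only for an error term of lower
  -- order, so the constant is harmless.
  transitivity≤3 : ∀ x y z → transitivity x y z ≤ 3
  transitivity≤3 x y z = +-mono-≤ (+-mono-≤ (bound x y z) (bound y x z)) (bound z x y)
    where
    bound : ∀ x y z → adj x y * adj x z ≤ 1
    bound x y z = *-mono-≤ (indicator≤1 (arc T x y)) (indicator≤1 (arc T x z))

  arc-reverse : ∀ {x y} → x ≢ y → arc T y x ≡ not (arc T x y)
  arc-reverse {x} {y} x≢y with total T x y x≢y
  ... | inj₁ (p , q) = trans q (cong not (sym p))
  ... | inj₂ (p , q) = trans p (cong not (sym q))

  private
    outdegree : Fin n → ℕ
    outdegree x = ∑[ y < n ] adj x y

    square : ∀ x → ∑[ y < n ] ∑[ z < n ] (adj x y * adj x z) ≡ outdegree x * outdegree x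
    square x = begin
      ∑[ y < n ] ∑[ z < n ] (adj x y * adj x z) ≡⟨ sum-cong-≗ {n} (λ y → sym (*-distribˡ-sum {n} (adj x y) (adj x))) ⟩
      ∑[ y < n ] (adj x y * outdegree x)        ≡⟨ sum-cong-≗ {n} (λ y → *-comm (adj x y) _) ⟩
      ∑[ y < n ] (outdegree x * adj x y)        ≡⟨ sym (*-distribˡ-sum {n} (outdegree x) (adj x)) ⟩
      outdegree x * outdegree x                 ∎
      where open ≡-Reasoning

    squares : ℕ
    squares = ∑[ x < n ] (outdegree x * outdegree x)

    source₁ : ∑³ (λ x y z → adj x y * adj x z) ≡ squares
    source₁ = sum-cong-≗ {n} square

    source₂ : ∑³ (λ x y z → adj y x * adj y z) ≡ squares
    source₂ = trans (∑-comm {n} {n} (λ x y → ∑[ z < n ] (adj y x * adj y z))) source₁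

    source₃ : ∑³ (λ x y z → adj z x * adj z y) ≡ squares
    source₃ = trans (sum-cong-≗ {n} (λ x → ∑-comm {n} {n} (λ y z → adj z x * adj z y))) source₂

    -- A transitive triple is determined by its source and the two vertices below it, so each of the
    -- three summands contributes the sum of squared out-degrees.
    sum-transitivity : ∑³ transitivity ≡ 3 * squares
    sum-transitivity = begin
      ∑³ transitivity             ≡⟨ ∑³-+ (λ x y z → adj x y * adj x z + adj y x * adj y z) (λ x y z → adj z x * adj z y) ⟩
      ∑³ (λ x y z → adj x y * adj x z + adj y x * adj y z) + ∑³ (λ x y z → adj z x * adj z y)
                                  ≡⟨ cong₂ _+_ (∑³-+ (λ x y z → adj x y * adj x z) (λ x y z → adj y x * adj y z)) source₃ ⟩
      ∑³ (λ x y z → adj x y * adj x z) + ∑³ (λ x y z → adj y x * adj y z) + squares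
                                  ≡⟨ cong (_+ squares) (cong₂ _+_ source₁ source₂) ⟩
      squares + squares + squares ≡⟨ three squares ⟩
      3 * squares                 ∎
      where
      open ≡-Reasoning
      three : ∀ a → a + a + a ≡ 3 * a
      three = solve-∀

    adj-total : ∀ x y → 1 ≤ adj x y + adj y x + δ x y
    adj-total x y with x Fin.≟ y
    ... | yes refl = ≤-trans (≤-reflexive (sym (δ-diagonal x))) (m≤n+m _ _)
    ... | no  x≢y  = ≤-trans (≤-reflexive (sym (flip (arc T x y) _ (arc-reverse x≢y)))) (m≤m+n _ _)
      where
      flip : ∀ b c → c ≡ not b → indicator b + indicator c ≡ 1
      flip true  _ refl = refl
      flip false _ refl = refl

    arcs : n * n ≤ 2 * sum outdegree + n
    arcs = begin
      n * n                                                  ≡⟨ cong (n *_) (sym (*-identityʳ n)) ⟩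
      n * (n * 1)                                            ≡⟨ sym (trans (sum-cong-≗ {n} (λ _ → sum-const n 1)) (sum-const n _)) ⟩
      ∑[ _ < n ] ∑[ _ < n ] 1                                ≤⟨ sum-mono {n} (λ x → sum-mono {n} (adj-total x)) ⟩
      ∑[ x < n ] ∑[ y < n ] (adj x y + adj y x + δ x y)      ≡⟨ split (λ x y → adj x y + adj y x) δ ⟩
      ∑[ x < n ] ∑[ y < n ] (adj x y + adj y x) + ∑[ x < n ] ∑[ y < n ] δ x y
        ≡⟨ cong₂ _+_ (split adj (λ x y → adj y x)) (trans (sum-cong-≗ {n} sum-δ) (trans (sum-const n 1) (*-identityʳ n))) ⟩
      sum outdegree + ∑[ x < n ] ∑[ y < n ] adj y x + n      ≡⟨ cong (λ s → sum outdegree + s + n) (∑-comm {n} {n} (λ x y → adj y x)) ⟩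
      sum outdegree + sum outdegree + n                      ≡⟨ cong (_+ n) (cong (sum outdegree +_) (sym (+-identityʳ _))) ⟩
      2 * sum outdegree + n                                  ∎
      where
      open ≤-Reasoning
      split : ∀ (f g : Fin n → Fin n → ℕ) → ∑[ x < n ] ∑[ y < n ] (f x y + g x y) ≡
              ∑[ x < n ] ∑[ y < n ] f x y + ∑[ x < n ] ∑[ y < n ] g x y
      split f g = trans (sum-cong-≗ {n} (λ x → ∑-distrib-+ {n} (f x) (g x))) (∑-distrib-+ {n} _ _)

    am-gm : ∀ a b → 2 * (a * b) ≤ a * a + b * b
    am-gm a b with ≤-total a b
    ... | inj₁ a≤b with d , refl ← m≤n⇒∃[o]m+o≡n a≤b =
      subst (2 * (a * (a + d)) ≤_) (sym (expand a d)) (m≤m+n _ _)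
      where
      expand : ∀ a d → a * a + (a + d) * (a + d) ≡ 2 * (a * (a + d)) + d * d
      expand = solve-∀
    ... | inj₂ b≤a with d , refl ← m≤n⇒∃[o]m+o≡n b≤a =
      subst (2 * ((b + d) * b) ≤_) (sym (expand b d)) (m≤m+n _ _)
      where
      expand : ∀ b d → (b + d) * (b + d) + b * b ≡ 2 * ((b + d) * b) + d * d
      expand = solve-∀

    -- The tangent 4 n d - n² to 4 d² at the mean out-degree d = n / 2 replaces the Cauchy-Schwarz
    -- inequality; it is sharp for regular tournaments.
    convexity : 4 * n * sum outdegree ≤ 4 * squares + n * (n * n)
    convexity = begin
      4 * n * sum outdegree                                  ≡⟨ *-distribˡ-sum {n} (4 * n) outdegree ⟩
      ∑[ x < n ] (4 * n * outdegree x)                       ≤⟨ sum-mono {n} (λ x → pointwise (outdegree x)) ⟩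
      ∑[ x < n ] (4 * (outdegree x * outdegree x) + n * n)   ≡⟨ ∑-distrib-+ {n} _ _ ⟩
      ∑[ x < n ] (4 * (outdegree x * outdegree x)) + ∑[ _ < n ] (n * n)
        ≡⟨ cong₂ _+_ (sym (*-distribˡ-sum {n} 4 _)) (sum-const n _) ⟩
      4 * squares + n * (n * n)                              ∎
      where
      open ≤-Reasoning
      expand₁ : ∀ n d → 4 * n * d ≡ 2 * ((2 * d) * n)
      expand₁ = solve-∀
      expand₂ : ∀ n d → (2 * d) * (2 * d) + n * n ≡ 4 * (d * d) + n * n
      expand₂ = solve-∀
      pointwise : ∀ d → 4 * n * d ≤ 4 * (d * d) + n * n
      pointwise d = subst₂ _≤_ (sym (expand₁ n d)) (expand₂ n d) (am-gm (2 * d) n)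

  sum-transitivity≥ : 3 * (n * (n * n)) ≤ 4 * ∑³ transitivity + 6 * (n * n)
  sum-transitivity≥ = +-cancelˡ-≤ (3 * (n * (n * n))) _ _ (begin
    3 * (n * (n * n)) + 3 * (n * (n * n))                       ≡⟨ e₁ n ⟩
    6 * n * (n * n)                                             ≤⟨ *-monoʳ-≤ (6 * n) arcs ⟩
    6 * n * (2 * sum outdegree + n)                             ≡⟨ e₂ n (sum outdegree) ⟩
    3 * (4 * n * sum outdegree) + 6 * (n * n)                   ≤⟨ +-monoˡ-≤ (6 * (n * n)) (*-monoʳ-≤ 3 convexity) ⟩
    3 * (4 * squares + n * (n * n)) + 6 * (n * n)               ≡⟨ e₃ n squares ⟩
    3 * (n * (n * n)) + (4 * (3 * squares) + 6 * (n * n))       ≡⟨ cong (λ s → 3 * (n * (n * n)) + (4 * s + 6 * (n * n))) (sym sum-transitivity) ⟩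
    3 * (n * (n * n)) + (4 * ∑³ transitivity + 6 * (n * n))     ∎)
    where
    open ≤-Reasoning
    e₁ : ∀ n → 3 * (n * (n * n)) + 3 * (n * (n * n)) ≡ 6 * n * (n * n)
    e₁ = solve-∀
    e₂ : ∀ n d → 6 * n * (2 * d + n) ≡ 3 * (4 * n * d) + 6 * (n * n)
    e₂ = solve-∀
    e₃ : ∀ n s → 3 * (4 * s + n * (n * n)) + 6 * (n * n) ≡ 3 * (n * (n * n)) + (4 * (3 * s) + 6 * (n * n))
    e₃ = solve-∀

-- Packings

-- `E` bounds the region of edges that the triples may use. Unions then need only disjoint regions,
-- and no triples have to be compared.
record Packing {n} (T : Tournament n) (E : Edge n → Set) (m : ℕ) : Set where
  constructor packing
  field
    triples  : List (Triple n)
    disjoint : EdgeDisjointTT3s T triples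
    inside   : All E (concatMap edgesOf triples)
    size     : length triples ≡ m

module _ {n : ℕ} {T : Tournament n} where

  emptyPacking : ∀ {E} → Packing T E 0
  emptyPacking = packing [] ([] , []) [] refl

  weaken : ∀ {E F m} → (∀ {e} → E e → F e) → Packing T E m → Packing T F m
  weaken E⊆F (packing ts d i s) = packing ts d (All.map E⊆F i) s

  union : ∀ {E F l m} → (∀ {e} → E e → F e → ⊥) → Packing T E l → Packing T F m →
          Packing T (λ e → E e ⊎ F e) (l + m)
  union E∩F (packing ts (tt₁ , u₁) i₁ s₁) (packing us (tt₂ , u₂) i₂ s₂) = packing (ts ++ us)
    ( All.++⁺ tt₁ tt₂
    , subst Unique (sym split) (Unique.++⁺ u₁ u₂ λ (p , q) → E∩F (All.lookup i₁ p) (All.lookup i₂ q)))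
    (subst (All _) (sym split) (All.++⁺ (All.map inj₁ i₁) (All.map inj₂ i₂)))
    (trans (length-++ ts) (cong₂ _+_ s₁ s₂))
    where split = concatMap-++ edgesOf ts us

  ⋃ : ∀ k {E : Fin k → Edge n → Set} {m : Fin k → ℕ} →
      (∀ {i j e} → E i e → E j e → i ≡ j) → (∀ i → Packing T (E i) (m i)) →
      Packing T (λ e → ∃[ i ] E i e) (sum m)
  ⋃ zero    E∩E ps = emptyPacking
  ⋃ (suc k) E∩E ps = weaken (λ { (inj₁ p) → zero , p ; (inj₂ (i , p)) → suc i , p })
    (union (λ { p (i , q) → Fin.0≢1+n (E∩E p q) }) (ps zero)
           (⋃ k (λ p q → Fin.suc-injective (E∩E p q)) (ps ∘ suc)))

  ⋃-list : ∀ {I : Set} {E : I → Edge n → Set} {m : I → ℕ} {L} →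
           AllPairs (λ i j → ∀ e → E i e → E j e → ⊥) L → All (λ i → Packing T (E i) (m i)) L →
           Packing T (λ e → Any (λ i → E i e) L) (sumₗ (map m L))
  ⋃-list []       []       = emptyPacking
  ⋃-list {E = E} {L = _ ∷ L} (d ∷ ds) (p ∷ ps) = weaken (λ { (inj₁ e) → here e ; (inj₂ e) → there e })
    (union (λ e es → disjoint d e es) p (⋃-list ds ps))
    where
    disjoint : ∀ {i e L} → All (λ j → ∀ e → E i e → E j e → ⊥) L → E i e → Any (λ j → E j e) L → ⊥
    disjoint (d ∷ _)  p (here q)  = d _ p q
    disjoint (_ ∷ ds) p (there q) = disjoint ds p q

restrict : ∀ {m n} (φ : Fin m → Fin n) → (∀ {x y} → φ x ≡ φ y → x ≡ y) → Tournament n → Tournament m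
restrict φ φ-inj T = record
  { arc      = λ x y → arc T (φ x) (φ y)
  ; loopless = λ x → loopless T (φ x)
  ; total    = λ x y x≢y → total T (φ x) (φ y) (x≢y ∘ φ-inj)
  }

transport : ∀ {m n} (φ : Fin m → Fin n) (φ-inj : ∀ {x y} → φ x ≡ φ y → x ≡ y) {T E s} →
            Packing (restrict φ φ-inj T) E s →
            Packing T (λ e → ∃[ (x , y) ] E (x , y) × e ≡ (φ x , φ y)) s
transport φ φ-inj {T} {E} (packing ts (tts , u) i s) = packing (map φ³ ts)
  ( All.map⁺ tts
  , subst Unique edges (Unique.map⁺ φ²-inj u))
  (subst (All _) edges (All.map⁺ (All.map (λ {e} p → e , p , refl) i)))
  (trans (length-map φ³ ts) s)
  where
  φ² = λ (x , y) → φ x , φ y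
  φ³ = λ (x , y , z) → φ x , φ y , φ z
  φ²-inj : ∀ {e f} → φ² e ≡ φ² f → e ≡ f
  φ²-inj eq = cong₂ _,_ (φ-inj (cong proj₁ eq)) (φ-inj (cong proj₂ eq))
  edges : map φ² (concatMap edgesOf ts) ≡ concatMap edgesOf (map φ³ ts)
  edges = trans (map-concatMap φ² edgesOf ts) (sym (concatMap-map edgesOf φ³ ts))

-- The arguments are the orientations of xy, xz, yz. The triple is cyclic exactly when xy and yz
-- agree and xz is opposite to them.
cyclicity : Bool → Bool → Bool → ℕ
cyclicity true  false true  = 1
cyclicity false true  false = 1
cyclicity _     _     _     = 0

-- Both directions of each pair are listed, so the region of a line does not depend on the
-- tournament.
pairsOf : ∀ {n} → Triple n → List (Edge n)
pairsOf (x , y , z) = (x , y) ∷ (x , z) ∷ (y , x) ∷ (y , z) ∷ (z , x) ∷ (z , y) ∷ []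

module _ {n : ℕ} (T : Tournament n) where

  singleton : ∀ {E x y z} → IsTT3 T (x , y , z) → x ≢ y → x ≢ z → y ≢ z →
              E (x , y) → E (x , z) → E (y , z) → Packing T E 1
  singleton t x≢y x≢z y≢z p q r = packing (_ ∷ []) (t ∷ [] , u) (p ∷ q ∷ r ∷ []) refl
    where
    u = (y≢z ∘ cong proj₂ ∷ x≢y ∘ cong proj₁ ∷ []) ∷ (x≢y ∘ cong proj₁ ∷ []) ∷ [] ∷ []

  module _ {x y z : Fin n} (x≢y : x ≢ y) (x≢z : x ≢ z) (y≢z : y ≢ z) where

    transitivity+cyclicity : transitivity T x y z + cyclicity (arc T x y) (arc T x z) (arc T y z) ≡ 1
    transitivity+cyclicity
      rewrite arc-reverse T x≢y | arc-reverse T x≢z | arc-reverse T y≢z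
      with arc T x y | arc T x z | arc T y z
    ... | true  | true  | true  = refl
    ... | true  | true  | false = refl
    ... | true  | false | true  = refl
    ... | true  | false | false = refl
    ... | false | true  | true  = refl
    ... | false | true  | false = refl
    ... | false | false | true  = refl
    ... | false | false | false = refl

    -- Taking `transitivity` itself as the size, with an empty packing for a cyclic triple, lets the
    -- lines of a plane be united without selecting the transitive ones.
    triplePacking : Packing T (_∈ pairsOf (x , y , z)) (transitivity T x y z)
    triplePacking
      -- Eliminating the reversed arcs leaves the eight orientations of xy, xz, yz; the six
      -- transitive ones are listed from source to sink.
      rewrite arc-reverse T x≢y | arc-reverse T x≢z | arc-reverse T y≢z
      with arc T x y in xy | arc T x z in xz | arc T y z in yz
    ... | true  | true  | true  = singleton (xy , xz , yz) x≢y x≢z y≢z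
                                    (here refl) (there (here refl)) (there (there (there (here refl))))
    ... | true  | true  | false = singleton (xz , xy , trans (arc-reverse T y≢z) (cong not yz)) x≢z x≢y (y≢z ∘ sym)
                                    (there (here refl)) (here refl) (there (there (there (there (there (here refl))))))
    ... | true  | false | true  = emptyPacking
    ... | true  | false | false = singleton (trans (arc-reverse T x≢z) (cong not xz) , trans (arc-reverse T y≢z) (cong not yz) , xy)
                                    (x≢z ∘ sym) (y≢z ∘ sym) x≢y
                                    (there (there (there (there (here refl))))) (there (there (there (there (there (here refl)))))) (here refl)
    ... | false | true  | true  = singleton (trans (arc-reverse T x≢y) (cong not xy) , yz , xz) (x≢y ∘ sym) y≢z x≢z
                                    (there (there (here refl))) (there (there (there (here refl)))) (there (here refl))
    ... | false | true  | false = emptyPacking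
    ... | false | false | true  = singleton (yz , trans (arc-reverse T x≢y) (cong not xy) , trans (arc-reverse T x≢z) (cong not xz))
                                    y≢z (x≢y ∘ sym) (x≢z ∘ sym)
                                    (there (there (there (here refl)))) (there (there (here refl))) (there (there (there (there (here refl)))))
    ... | false | false | false = singleton (trans (arc-reverse T y≢z) (cong not yz) , trans (arc-reverse T x≢z) (cong not xz) , trans (arc-reverse T x≢y) (cong not xy))
                                    (y≢z ∘ sym) (x≢z ∘ sym) (x≢y ∘ sym)
                                    (there (there (there (there (there (here refl)))))) (there (there (there (there (here refl))))) (there (there (here refl)))

-- Seven vertices: the exhaustive search

pairs : ∀ {A : Set} → List A → List (A × A)
pairs []       = []
pairs (x ∷ xs) = map (x ,_) xs ++ pairs xs

triples : ∀ {A : Set} → List A → List (A × A × A)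
triples []       = []
triples (x ∷ xs) = map (x ,_) (pairs xs) ++ triples xs

Line : Set
Line = ℕ × ℕ × ℕ

-- These are the 7! / 168 = 30 labelled Fano planes, grouped by the line through 0 and 1. Lines are
-- increasing, in accordance with the order ij, ik, jk of `Clause`.
fanoPlanes : List (List Line)
fanoPlanes =
  ( ((0 , 1 , 2) ∷ (0 , 3 , 4) ∷ (0 , 5 , 6) ∷ (1 , 3 , 5) ∷ (1 , 4 , 6) ∷ (2 , 3 , 6) ∷ (2 , 4 , 5) ∷ [])
  ∷ ((0 , 1 , 2) ∷ (0 , 3 , 4) ∷ (0 , 5 , 6) ∷ (1 , 3 , 6) ∷ (1 , 4 , 5) ∷ (2 , 3 , 5) ∷ (2 , 4 , 6) ∷ [])
  ∷ ((0 , 1 , 2) ∷ (0 , 3 , 5) ∷ (0 , 4 , 6) ∷ (1 , 3 , 4) ∷ (1 , 5 , 6) ∷ (2 , 3 , 6) ∷ (2 , 4 , 5) ∷ [])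
  ∷ ((0 , 1 , 2) ∷ (0 , 3 , 5) ∷ (0 , 4 , 6) ∷ (1 , 3 , 6) ∷ (1 , 4 , 5) ∷ (2 , 3 , 4) ∷ (2 , 5 , 6) ∷ [])
  ∷ ((0 , 1 , 2) ∷ (0 , 3 , 6) ∷ (0 , 4 , 5) ∷ (1 , 3 , 4) ∷ (1 , 5 , 6) ∷ (2 , 3 , 5) ∷ (2 , 4 , 6) ∷ [])
  ∷ ((0 , 1 , 2) ∷ (0 , 3 , 6) ∷ (0 , 4 , 5) ∷ (1 , 3 , 5) ∷ (1 , 4 , 6) ∷ (2 , 3 , 4) ∷ (2 , 5 , 6) ∷ [])
  ∷ ((0 , 1 , 3) ∷ (0 , 2 , 4) ∷ (0 , 5 , 6) ∷ (1 , 2 , 5) ∷ (1 , 4 , 6) ∷ (2 , 3 , 6) ∷ (3 , 4 , 5) ∷ [])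
  ∷ ((0 , 1 , 3) ∷ (0 , 2 , 4) ∷ (0 , 5 , 6) ∷ (1 , 2 , 6) ∷ (1 , 4 , 5) ∷ (2 , 3 , 5) ∷ (3 , 4 , 6) ∷ [])
  ∷ ((0 , 1 , 3) ∷ (0 , 2 , 5) ∷ (0 , 4 , 6) ∷ (1 , 2 , 4) ∷ (1 , 5 , 6) ∷ (2 , 3 , 6) ∷ (3 , 4 , 5) ∷ [])
  ∷ ((0 , 1 , 3) ∷ (0 , 2 , 5) ∷ (0 , 4 , 6) ∷ (1 , 2 , 6) ∷ (1 , 4 , 5) ∷ (2 , 3 , 4) ∷ (3 , 5 , 6) ∷ [])
  ∷ ((0 , 1 , 3) ∷ (0 , 2 , 6) ∷ (0 , 4 , 5) ∷ (1 , 2 , 4) ∷ (1 , 5 , 6) ∷ (2 , 3 , 5) ∷ (3 , 4 , 6) ∷ [])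
  ∷ ((0 , 1 , 3) ∷ (0 , 2 , 6) ∷ (0 , 4 , 5) ∷ (1 , 2 , 5) ∷ (1 , 4 , 6) ∷ (2 , 3 , 4) ∷ (3 , 5 , 6) ∷ [])
  ∷ ((0 , 1 , 4) ∷ (0 , 2 , 3) ∷ (0 , 5 , 6) ∷ (1 , 2 , 5) ∷ (1 , 3 , 6) ∷ (2 , 4 , 6) ∷ (3 , 4 , 5) ∷ [])
  ∷ ((0 , 1 , 4) ∷ (0 , 2 , 3) ∷ (0 , 5 , 6) ∷ (1 , 2 , 6) ∷ (1 , 3 , 5) ∷ (2 , 4 , 5) ∷ (3 , 4 , 6) ∷ [])
  ∷ ((0 , 1 , 4) ∷ (0 , 2 , 5) ∷ (0 , 3 , 6) ∷ (1 , 2 , 3) ∷ (1 , 5 , 6) ∷ (2 , 4 , 6) ∷ (3 , 4 , 5) ∷ [])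
  ∷ ((0 , 1 , 4) ∷ (0 , 2 , 5) ∷ (0 , 3 , 6) ∷ (1 , 2 , 6) ∷ (1 , 3 , 5) ∷ (2 , 3 , 4) ∷ (4 , 5 , 6) ∷ [])
  ∷ ((0 , 1 , 4) ∷ (0 , 2 , 6) ∷ (0 , 3 , 5) ∷ (1 , 2 , 3) ∷ (1 , 5 , 6) ∷ (2 , 4 , 5) ∷ (3 , 4 , 6) ∷ [])
  ∷ ((0 , 1 , 4) ∷ (0 , 2 , 6) ∷ (0 , 3 , 5) ∷ (1 , 2 , 5) ∷ (1 , 3 , 6) ∷ (2 , 3 , 4) ∷ (4 , 5 , 6) ∷ [])
  ∷ ((0 , 1 , 5) ∷ (0 , 2 , 3) ∷ (0 , 4 , 6) ∷ (1 , 2 , 4) ∷ (1 , 3 , 6) ∷ (2 , 5 , 6) ∷ (3 , 4 , 5) ∷ [])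
  ∷ ((0 , 1 , 5) ∷ (0 , 2 , 3) ∷ (0 , 4 , 6) ∷ (1 , 2 , 6) ∷ (1 , 3 , 4) ∷ (2 , 4 , 5) ∷ (3 , 5 , 6) ∷ [])
  ∷ ((0 , 1 , 5) ∷ (0 , 2 , 4) ∷ (0 , 3 , 6) ∷ (1 , 2 , 3) ∷ (1 , 4 , 6) ∷ (2 , 5 , 6) ∷ (3 , 4 , 5) ∷ [])
  ∷ ((0 , 1 , 5) ∷ (0 , 2 , 4) ∷ (0 , 3 , 6) ∷ (1 , 2 , 6) ∷ (1 , 3 , 4) ∷ (2 , 3 , 5) ∷ (4 , 5 , 6) ∷ [])
  ∷ ((0 , 1 , 5) ∷ (0 , 2 , 6) ∷ (0 , 3 , 4) ∷ (1 , 2 , 3) ∷ (1 , 4 , 6) ∷ (2 , 4 , 5) ∷ (3 , 5 , 6) ∷ [])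
  ∷ ((0 , 1 , 5) ∷ (0 , 2 , 6) ∷ (0 , 3 , 4) ∷ (1 , 2 , 4) ∷ (1 , 3 , 6) ∷ (2 , 3 , 5) ∷ (4 , 5 , 6) ∷ [])
  ∷ ((0 , 1 , 6) ∷ (0 , 2 , 3) ∷ (0 , 4 , 5) ∷ (1 , 2 , 4) ∷ (1 , 3 , 5) ∷ (2 , 5 , 6) ∷ (3 , 4 , 6) ∷ [])
  ∷ ((0 , 1 , 6) ∷ (0 , 2 , 3) ∷ (0 , 4 , 5) ∷ (1 , 2 , 5) ∷ (1 , 3 , 4) ∷ (2 , 4 , 6) ∷ (3 , 5 , 6) ∷ [])
  ∷ ((0 , 1 , 6) ∷ (0 , 2 , 4) ∷ (0 , 3 , 5) ∷ (1 , 2 , 3) ∷ (1 , 4 , 5) ∷ (2 , 5 , 6) ∷ (3 , 4 , 6) ∷ [])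
  ∷ ((0 , 1 , 6) ∷ (0 , 2 , 4) ∷ (0 , 3 , 5) ∷ (1 , 2 , 5) ∷ (1 , 3 , 4) ∷ (2 , 3 , 6) ∷ (4 , 5 , 6) ∷ [])
  ∷ ((0 , 1 , 6) ∷ (0 , 2 , 5) ∷ (0 , 3 , 4) ∷ (1 , 2 , 3) ∷ (1 , 4 , 5) ∷ (2 , 4 , 6) ∷ (3 , 5 , 6) ∷ [])
  ∷ ((0 , 1 , 6) ∷ (0 , 2 , 5) ∷ (0 , 3 , 4) ∷ (1 , 2 , 4) ∷ (1 , 3 , 5) ∷ (2 , 3 , 6) ∷ (4 , 5 , 6) ∷ [])
  ∷ [])

-- The cyclicity of the triple i < j < k, with the orientations of none, the first, or the
-- first two of the pairs ij, ik, jk already fixed (the last two to opposite values).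
data Clause : Set where
  free   : ℕ → ℕ → ℕ → Clause
  fixed₁ : Bool → ℕ → ℕ → ℕ → Clause
  fixed₂ : Bool → ℕ → ℕ → ℕ → Clause

data Outcome : Set where
  pend : Clause → Outcome
  cyclic transitive : Outcome

agree : Bool → Bool → Bool
agree true  b = b
agree false b = not b

-- Only the next unset pair of a clause is examined. The search fixes pairs in lexicographic order,
-- so ij, ik, jk arrive in this order. Equal ij and ik settle the triple as transitive; otherwise jk
-- decides.
assign : ℕ → ℕ → Bool → Clause → Outcome
assign p q b (free i j k) =
  if (i ≡ᵇ p) ∧ (j ≡ᵇ q) then pend (fixed₁ b i j k) else pend (free i j k)
assign p q b (fixed₁ a i j k) =
  if (i ≡ᵇ p) ∧ (k ≡ᵇ q) then (if agree a b then transitive else pend (fixed₂ a i j k)) else pend (fixed₁ a i j k)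
assign p q b (fixed₂ a i j k) =
  if (j ≡ᵇ p) ∧ (k ≡ᵇ q) then (if agree a b then cyclic else transitive) else pend (fixed₂ a i j k)

record Residue : Set where
  constructor residue
  field
    cycles  : ℕ
    pending : List Clause

open Residue

add : Outcome → Residue → Residue
add (pend c)   (residue n cs) = residue n (c ∷ cs)
add cyclic     (residue n cs) = residue (suc n) cs
add transitive r              = r

orient : ℕ → ℕ → Bool → Residue → Residue
orient p q b (residue n cs) = foldr (λ c → add (assign p q b c)) (residue n []) cs

start : List Line → Residue
start ls = residue 0 (map (λ (i , j , k) → free i j k) ls)

-- With c the number of cyclic lines of a Fano plane and d the number of all cyclic triples,
-- 12 + (35 - d) ≤ 7 (7 - c) amounts to 7 c < 3 + d. Unsettled lines are counted as cyclic and
-- unsettled triples as transitive, so a win is final.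
wins : Residue → Residue → Bool
wins t p = 7 * (cycles p + length (pending p)) <ᵇ 3 + cycles t

-- A branch is cut once some plane has won for all completions; different branches may end with
-- different planes. The depth is at most 15, the number of pairs among the vertices 1, ..., 6.
search : List (ℕ × ℕ) → Residue → List Residue → Bool
search []             t ps = any (wins t) ps
search ((p , q) ∷ es) t ps = if any (wins t) ps then true else
  search es (orient p q true  t) (map (orient p q true)  ps) ∧
  search es (orient p q false t) (map (orient p q false) ps)

-- Vertex 0 beats exactly 1, …, k; every case can be relabelled to this one.
orientFirst : ℕ → Residue → Residue
orientFirst k r = foldl (λ r j → orient 0 (suc j) (j <ᵇ k) r) r (upTo 6)

check : ℕ → Bool
check k = search (pairs (map suc (upTo 6))) (orientFirst k (start (triples (upTo 7)))) (map (orientFirst k ∘ start) fanoPlanes)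

-- Soundness of the search

module _ (o : ℕ → ℕ → Bool) where

  lineCyclicity : Line → ℕ
  lineCyclicity (i , j , k) = cyclicity (o i j) (o i k) (o j k)

  value : Clause → ℕ
  value (free i j k)     = cyclicity (o i j) (o i k) (o j k)
  value (fixed₁ a i j k) = cyclicity a (o i k) (o j k)
  value (fixed₂ a i j k) = cyclicity a (not a) (o j k)

  outcomeValue : Outcome → ℕ
  outcomeValue (pend c)   = value c
  outcomeValue cyclic     = 1
  outcomeValue transitive = 0

  residueValue : Residue → ℕ
  residueValue (residue n cs) = n + sumₗ (map value cs)

  private
    match : ∀ i j p q {b} → o p q ≡ b → T ((i ≡ᵇ p) ∧ (j ≡ᵇ q)) → o i j ≡ b
    match i j p q refl t with Equivalence.to (T-∧ {i ≡ᵇ p}) t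
    ... | ti , tj rewrite ≡ᵇ⇒≡ i p ti | ≡ᵇ⇒≡ j q tj = refl

  assign-value : ∀ p q {b} → o p q ≡ b → ∀ c → outcomeValue (assign p q b c) ≡ value c
  assign-value p q {b} eq (free i j k) with (i ≡ᵇ p) ∧ (j ≡ᵇ q) in m
  ... | false = refl
  ... | true  rewrite match i j p q eq (subst T (sym m) tt) = refl
  assign-value p q {b} eq (fixed₁ a i j k) with (i ≡ᵇ p) ∧ (k ≡ᵇ q) in m
  ... | false = refl
  ... | true  rewrite match i k p q eq (subst T (sym m) tt) with a | b
  ...   | true  | true  = lemma (o j k) where
    lemma : ∀ c → 0 ≡ cyclicity true true c
    lemma true  = refl
    lemma false = refl
  ...   | true  | false = refl
  ...   | false | true  = refl
  ...   | false | false = lemma (o j k) where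
    lemma : ∀ c → 0 ≡ cyclicity false false c
    lemma true  = refl
    lemma false = refl
  assign-value p q {b} eq (fixed₂ a i j k) with (j ≡ᵇ p) ∧ (k ≡ᵇ q) in m
  ... | false = refl
  ... | true  rewrite match j k p q eq (subst T (sym m) tt) with a | b
  ...   | true  | true  = refl
  ...   | true  | false = refl
  ...   | false | true  = refl
  ...   | false | false = refl

  add-value : ∀ x r → residueValue (add x r) ≡ outcomeValue x + residueValue r
  add-value (pend c)   (residue n cs) = lemma n (value c) _ where
    lemma : ∀ n v s → n + (v + s) ≡ v + (n + s)
    lemma = solve-∀
  add-value cyclic     r = refl
  add-value transitive r = refl

  -- The invariant of the search: along the branch that follows `o`, fixing a pair rewrites the
  -- clauses but preserves the number of cyclic triples that they stand for.
  orient-value : ∀ p q {b} → o p q ≡ b → ∀ r → residueValue (orient p q b r) ≡ residueValue r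
  orient-value p q {b} eq (residue n []) = refl
  orient-value p q {b} eq (residue n (c ∷ cs)) = begin
    residueValue (add (assign p q b c) (orient p q b (residue n cs)))    ≡⟨ add-value (assign p q b c) _ ⟩
    outcomeValue (assign p q b c) + residueValue (orient p q b (residue n cs))
      ≡⟨ cong₂ _+_ (assign-value p q eq c) (orient-value p q eq (residue n cs)) ⟩
    value c + (n + sumₗ (map value cs))                                 ≡⟨ lemma (value c) n _ ⟩
    n + (value c + sumₗ (map value cs))                                 ∎
    where
    open ≡-Reasoning
    lemma : ∀ v n s → v + (n + s) ≡ n + (v + s)
    lemma = solve-∀

  cyclicity≤1 : ∀ a b c → cyclicity a b c ≤ 1
  cyclicity≤1 true  true  c     = z≤n
  cyclicity≤1 true  false true  = ≤-refl
  cyclicity≤1 true  false false = z≤n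
  cyclicity≤1 false true  true  = z≤n
  cyclicity≤1 false true  false = ≤-refl
  cyclicity≤1 false false c     = z≤n

  value≤1 : ∀ c → value c ≤ 1
  value≤1 (free i j k)     = cyclicity≤1 (o i j) (o i k) (o j k)
  value≤1 (fixed₁ a i j k) = cyclicity≤1 a (o i k) (o j k)
  value≤1 (fixed₂ a i j k) = cyclicity≤1 a (not a) (o j k)

  pending-value : ∀ cs → sumₗ (map value cs) ≤ length cs
  pending-value []       = z≤n
  pending-value (c ∷ cs) = +-mono-≤ (value≤1 c) (pending-value cs)

  Good : Residue → Residue → Set
  Good t p = 7 * residueValue p < 3 + residueValue t

  wins-sound : ∀ t {p} → T (wins t p) → Good t p
  wins-sound (residue m ds) {residue n cs} w = begin-strict
    7 * (n + sumₗ (map value cs)) ≤⟨ *-monoʳ-≤ 7 (+-monoʳ-≤ n (pending-value cs)) ⟩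
    7 * (n + length cs)           <⟨ <ᵇ⇒< (7 * (n + length cs)) (3 + m) w ⟩
    3 + m                         ≤⟨ +-monoʳ-≤ 3 (m≤m+n m _) ⟩
    3 + (m + sumₗ (map value ds)) ∎
    where open ≤-Reasoning

  orient-sound : ∀ p q {b} → o p q ≡ b → ∀ t ps →
                 Any (Good (orient p q b t)) (map (orient p q b) ps) → Any (Good t) ps
  orient-sound p q eq t ps a = Any.map
    (λ {r} g → subst₂ (λ x y → 7 * x < 3 + y) (orient-value p q eq r) (orient-value p q eq t) g) (Any.map⁻ a)

  search-sound : ∀ es t ps → T (search es t ps) → Any (Good t) ps
  search-sound [] t ps s = Any.map (λ {p} → wins-sound t {p}) (Any.any⁻ (wins t) ps s)
  search-sound ((p , q) ∷ es) t ps s with any (wins t) ps in eq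
  ... | true  = Any.map (λ {p} → wins-sound t {p}) (Any.any⁻ (wins t) ps (subst T (sym eq) tt))
  ... | false with Equivalence.to (T-∧ {search es (orient p q true t) (map (orient p q true) ps)}) s | o p q in opq
  ...   | st , sf | true  = orient-sound p q opq t ps (search-sound es _ _ st)
  ...   | st , sf | false = orient-sound p q opq t ps (search-sound es _ _ sf)

  start-value : ∀ ls → residueValue (start ls) ≡ sumₗ (map lineCyclicity ls)
  start-value ls = cong sumₗ (sym (map-∘ ls))

  orientFirst-value : ∀ k → (∀ j → j < 6 → o 0 (suc j) ≡ (j <ᵇ k)) →
                      ∀ r → residueValue (orientFirst k r) ≡ residueValue r
  orientFirst-value k row r = go (upTo 6) r (All.map (row _) (All.all-upTo 6))
    where
    go : ∀ js r → All (λ j → o 0 (suc j) ≡ (j <ᵇ k)) js →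
         residueValue (foldl (λ r j → orient 0 (suc j) (j <ᵇ k) r) r js) ≡ residueValue r
    go []       r []       = refl
    go (j ∷ js) r (e ∷ es) = trans (go js _ es) (orient-value 0 (suc j) e r)

  check-sound : ∀ k → (∀ j → j < 6 → o 0 (suc j) ≡ (j <ᵇ k)) → T (check k) →
                Any (λ p → 7 * sumₗ (map lineCyclicity p) < 3 + sumₗ (map lineCyclicity (triples (upTo 7)))) fanoPlanes
  check-sound k row c = Any.map
    (λ {p} g → subst₂ (λ x y → 7 * x < 3 + y) (initial p) (initial (triples (upTo 7))) g)
    (Any.map⁻ {f = orientFirst k ∘ start} {xs = fanoPlanes}
      (search-sound (pairs (map suc (upTo 6))) (orientFirst k (start (triples (upTo 7)))) (map (orientFirst k ∘ start) fanoPlanes) c))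
    where
    initial : ∀ ls → residueValue (orientFirst k (start ls)) ≡ sumₗ (map lineCyclicity ls)
    initial ls = trans (orientFirst-value k row (start ls)) (start-value ls)

-- From Fano planes to packings on seven vertices

Distinct : ∀ {n} → Triple n → Set
Distinct (x , y , z) = x ≢ y × x ≢ z × y ≢ z

distinct? : ∀ {n} (t : Triple n) → Dec (Distinct t)
distinct? (x , y , z) = ¬? (x Fin.≟ y) ×-dec ¬? (x Fin.≟ z) ×-dec ¬? (y Fin.≟ z)

transitivityₜ : ∀ {n} → Tournament n → Triple n → ℕ
transitivityₜ T (x , y , z) = transitivity T x y z

cyclicityₜ : ∀ {n} → Tournament n → Triple n → ℕ
cyclicityₜ T (x , y , z) = cyclicity (arc T x y) (arc T x z) (arc T y z)

sum-transitivity+cyclicity : ∀ {n} (T : Tournament n) {ts} → All Distinct ts →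
  sumₗ (map (transitivityₜ T) ts) + sumₗ (map (cyclicityₜ T) ts) ≡ length ts
sum-transitivity+cyclicity T [] = refl
sum-transitivity+cyclicity T {t ∷ ts} ((p , q , r) ∷ ds) = begin
  (a + b) + (c + d) ≡⟨ interchange a b c d ⟩
  (a + c) + (b + d) ≡⟨ cong₂ _+_ (transitivity+cyclicity T p q r) (sum-transitivity+cyclicity T ds) ⟩
  suc (length ts)   ∎
  where
  open ≡-Reasoning
  a = transitivityₜ T t
  b = sumₗ (map (transitivityₜ T) ts)
  c = cyclicityₜ T t
  d = sumₗ (map (cyclicityₜ T) ts)

point : ℕ → Fin 7
point i = i mod 7

pointₗ : Line → Triple 7
pointₗ (i , j , k) = point i , point j , point k

sevenTriples : List (Triple 7)
sevenTriples = map pointₗ (triples (upTo 7))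

EdgeDisjoint : ∀ {n} → Triple n → Triple n → Set
EdgeDisjoint s t = All (_∉ pairsOf t) (pairsOf s)

-- Seven triples with disjoint pairs use 7 · 3 = 21 pairs, that is, every pair of the seven points
-- exactly once.
SteinerSystem : List (Triple 7) → Set
SteinerSystem ts = length ts ≡ 7 × All Distinct ts × AllPairs EdgeDisjoint ts

steinerSystem? : Decidable SteinerSystem
steinerSystem? ts = (length ts ≟ 7) ×-dec All.all? distinct? ts ×-dec
  allPairs? (λ s t → All.all? (λ e → ¬? (e ∈? pairsOf t)) (pairsOf s)) ts
  where open import Data.List.Membership.DecPropositional (≡-dec {A = Fin 7} {B = λ _ → Fin 7} Fin._≟_ Fin._≟_) using (_∈?_)

fanoPlanes-steiner : All (SteinerSystem ∘ map pointₗ) fanoPlanes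
fanoPlanes-steiner = toWitness {a? = All.all? (steinerSystem? ∘ map pointₗ) fanoPlanes} tt

sevenTriples-distinct : All Distinct sevenTriples
sevenTriples-distinct = toWitness {a? = All.all? distinct? sevenTriples} tt

steinerPacking : ∀ (H : Tournament 7) {ts} → SteinerSystem ts →
                 Packing H (λ _ → ⊤) (sumₗ (map (transitivityₜ H) ts))
steinerPacking H (_ , d , e) = weaken (λ _ → tt)
  (⋃-list {E = λ t e → e ∈ pairsOf t} (AllPairs.map (λ d e p q → All.lookup d p q) e)
          (All.map (λ (p , q , r) → triplePacking H p q r) d))

-- The finite computation itself: each `refl` evaluates the search for one out-degree of vertex 0.
check-true : ∀ {k} → k ≤ 6 → check k ≡ true
check-true {0} _ = refl
check-true {1} _ = refl
check-true {2} _ = refl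
check-true {3} _ = refl
check-true {4} _ = refl
check-true {5} _ = refl
check-true {6} _ = refl
check-true {suc (suc (suc (suc (suc (suc (suc k))))))} (s≤s (s≤s (s≤s (s≤s (s≤s (s≤s ()))))))

module _ (H : Tournament 7) where

  private
    o : ℕ → ℕ → Bool
    o i j = arc H (point i) (point j)

    arithmetic : ∀ m c t d → m + c ≡ 7 → t + d ≡ 35 → 7 * c < 3 + d → 12 + t ≤ 7 * m
    arithmetic m c t d m+c t+d c< = +-cancelʳ-≤ (7 * c) _ _ (begin
      12 + t + 7 * c    ≤⟨ +-monoʳ-≤ (12 + t) (≤-pred c<) ⟩
      12 + t + (2 + d)  ≡⟨ shuffle t d ⟩
      14 + (t + d)      ≡⟨ cong (14 +_) t+d ⟩
      7 * 7             ≡⟨ cong (7 *_) (sym m+c) ⟩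
      7 * (m + c)       ≡⟨ *-distribˡ-+ 7 m c ⟩
      7 * m + 7 * c     ∎)
      where
      open ≤-Reasoning
      shuffle : ∀ t d → 12 + t + (2 + d) ≡ 14 + (t + d)
      shuffle = solve-∀

    fewCycles : ∀ p ls → 7 * sumₗ (map (lineCyclicity o) p) < 3 + sumₗ (map (lineCyclicity o) ls) →
                SteinerSystem (map pointₗ p) → All Distinct (map pointₗ ls) → length (map pointₗ ls) ≡ 35 →
                ∃[ m ] Packing H (λ _ → ⊤) m × 12 + sumₗ (map (transitivityₜ H) (map pointₗ ls)) ≤ 7 * m
    fewCycles p ls few s@(size , d , _) d′ size′ = _ , steinerPacking H s ,
      arithmetic _ (sumₗ (map (cyclicityₜ H) (map pointₗ p))) _ (sumₗ (map (cyclicityₜ H) (map pointₗ ls)))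
        (trans (sum-transitivity+cyclicity H d) size) (trans (sum-transitivity+cyclicity H d′) size′)
        (subst₂ (λ x y → 7 * x < 3 + y) (cong sumₗ (map-∘ {g = cyclicityₜ H} {f = pointₗ} p)) (cong sumₗ (map-∘ {g = cyclicityₜ H} {f = pointₗ} ls)) few)

  opaque
    sevenPacking-sorted : ∀ k → k ≤ 6 → (∀ j → j < 6 → arc H (point 0) (point (suc j)) ≡ (j <ᵇ k)) →
      ∃[ m ] Packing H (λ _ → ⊤) m × 12 + sumₗ (map (transitivityₜ H) sevenTriples) ≤ 7 * m
    sevenPacking-sorted k k≤6 row = choose (check-sound o k row (subst T (sym (check-true k≤6)) tt)) fanoPlanes-steiner
      where
      choose : ∀ {ps} →
        Any (λ p → 7 * sumₗ (map (lineCyclicity o) p) < 3 + sumₗ (map (lineCyclicity o) (triples (upTo 7)))) ps →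
        All (SteinerSystem ∘ map pointₗ) ps →
        ∃[ m ] Packing H (λ _ → ⊤) m × 12 + sumₗ (map (transitivityₜ H) sevenTriples) ≤ 7 * m
      choose (here {p} few) (s ∷ _)  = fewCycles p (triples (upTo 7)) few s sevenTriples-distinct refl
      choose (there x)  (_ ∷ ss) = choose x ss

-- Seven vertices: reduction to an ordered first row

module _ {A : Set} where

  sum-pairs-∷ : ∀ (g : A × A → ℕ) x xs →
    sumₗ (map g (pairs (x ∷ xs))) ≡ sumₗ (map (λ y → g (x , y)) xs) + sumₗ (map g (pairs xs))
  sum-pairs-∷ g x xs = trans (cong sumₗ (map-++ g (map (x ,_) xs) (pairs xs)))
    (trans (sumₗ-++ (map g (map (x ,_) xs)) _) (cong (λ l → sumₗ l + sumₗ (map g (pairs xs))) (sym (map-∘ xs))))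

  sum-triples-∷ : ∀ (f : A × A × A → ℕ) x xs →
    sumₗ (map f (triples (x ∷ xs))) ≡ sumₗ (map (λ p → f (x , p)) (pairs xs)) + sumₗ (map f (triples xs))
  sum-triples-∷ f x xs = trans (cong sumₗ (map-++ f (map (x ,_) (pairs xs)) (triples xs)))
    (trans (sumₗ-++ (map f (map (x ,_) (pairs xs))) _)
           (cong (λ l → sumₗ l + sumₗ (map f (triples xs))) (sym (map-∘ (pairs xs)))))

  sum-map-↭ : ∀ (h : A → ℕ) {xs ys} → xs ↭ ys → sumₗ (map h xs) ≡ sumₗ (map h ys)
  sum-map-↭ h p = sum-↭ (map⁺ h p)

  sum-pairs-↭ : ∀ (g : A × A → ℕ) → (∀ x y → g (x , y) ≡ g (y , x)) →
                ∀ {xs ys} → xs ↭ ys → sumₗ (map g (pairs xs)) ≡ sumₗ (map g (pairs ys))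
  sum-pairs-↭ g g-sym ↭.refl = refl
  sum-pairs-↭ g g-sym {x ∷ xs} {_ ∷ ys} (prep x p) = begin
    sumₗ (map g (pairs (x ∷ xs)))                                  ≡⟨ sum-pairs-∷ g x xs ⟩
    sumₗ (map (λ y → g (x , y)) xs) + sumₗ (map g (pairs xs))
      ≡⟨ cong₂ _+_ (sum-map-↭ (λ y → g (x , y)) p) (sum-pairs-↭ g g-sym p) ⟩
    sumₗ (map (λ y → g (x , y)) ys) + sumₗ (map g (pairs ys))      ≡⟨ sum-pairs-∷ g x ys ⟨
    sumₗ (map g (pairs (x ∷ ys)))                                  ∎
    where open ≡-Reasoning
  sum-pairs-↭ g g-sym {_ ∷ _ ∷ xs} {_ ∷ _ ∷ ys} (swap x y p) = begin
    sumₗ (map g (pairs (x ∷ y ∷ xs)))                ≡⟨ expand x y xs ⟩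
    g (x , y) + X xs + (Y xs + P xs)                 ≡⟨ cong₂ _+_ (cong₂ _+_ (g-sym x y) (sum-map-↭ _ p)) (cong₂ _+_ (sum-map-↭ _ p) (sum-pairs-↭ g g-sym p)) ⟩
    g (y , x) + X ys + (Y ys + P ys)                 ≡⟨ interchange (g (y , x)) (X ys) (Y ys) (P ys) ⟩
    g (y , x) + Y ys + (X ys + P ys)                 ≡⟨ expand y x ys ⟨
    sumₗ (map g (pairs (y ∷ x ∷ ys)))                ∎
    where
    open ≡-Reasoning
    X Y P : List A → ℕ
    X zs = sumₗ (map (λ z → g (x , z)) zs)
    Y zs = sumₗ (map (λ z → g (y , z)) zs)
    P zs = sumₗ (map g (pairs zs))
    expand : ∀ x y zs → sumₗ (map g (pairs (x ∷ y ∷ zs))) ≡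
             g (x , y) + sumₗ (map (λ z → g (x , z)) zs) + (sumₗ (map (λ z → g (y , z)) zs) + P zs)
    expand x y zs = trans (sum-pairs-∷ g x (y ∷ zs)) (cong (sumₗ (map (λ z → g (x , z)) (y ∷ zs)) +_) (sum-pairs-∷ g y zs))
  sum-pairs-↭ g g-sym (↭.trans p q) = trans (sum-pairs-↭ g g-sym p) (sum-pairs-↭ g g-sym q)

  -- Relabelling also permutes the entries inside the listed triples. Invariance under the two
  -- adjacent transpositions makes the sum one over unordered triples.
  sum-triples-↭ : ∀ (f : A × A × A → ℕ) →
                  (∀ x y z → f (x , y , z) ≡ f (y , x , z)) → (∀ x y z → f (x , y , z) ≡ f (x , z , y)) →
                  ∀ {xs ys} → xs ↭ ys → sumₗ (map f (triples xs)) ≡ sumₗ (map f (triples ys))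
  sum-triples-↭ f f₁₂ f₂₃ ↭.refl = refl
  sum-triples-↭ f f₁₂ f₂₃ {x ∷ xs} {_ ∷ ys} (prep x p) = begin
    sumₗ (map f (triples (x ∷ xs)))                                     ≡⟨ sum-triples-∷ f x xs ⟩
    sumₗ (map (λ q → f (x , q)) (pairs xs)) + sumₗ (map f (triples xs))
      ≡⟨ cong₂ _+_ (sum-pairs-↭ (λ q → f (x , q)) (f₂₃ x) p) (sum-triples-↭ f f₁₂ f₂₃ p) ⟩
    sumₗ (map (λ q → f (x , q)) (pairs ys)) + sumₗ (map f (triples ys)) ≡⟨ sum-triples-∷ f x ys ⟨
    sumₗ (map f (triples (x ∷ ys)))                                     ∎
    where open ≡-Reasoning
  sum-triples-↭ f f₁₂ f₂₃ {_ ∷ _ ∷ xs} {_ ∷ _ ∷ ys} (swap x y p) = begin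
    sumₗ (map f (triples (x ∷ y ∷ xs)))              ≡⟨ expand x y xs ⟩
    XY xs + X xs + (Y xs + P xs)
      ≡⟨ cong₂ _+_ (cong₂ _+_ (sum-map-↭ _ p) (sum-pairs-↭ (λ q → f (x , q)) (f₂₃ x) p))
                   (cong₂ _+_ (sum-pairs-↭ (λ q → f (y , q)) (f₂₃ y) p) (sum-triples-↭ f f₁₂ f₂₃ p)) ⟩
    XY ys + X ys + (Y ys + P ys)                     ≡⟨ interchange (XY ys) (X ys) (Y ys) (P ys) ⟩
    XY ys + Y ys + (X ys + P ys)                     ≡⟨ cong (λ l → sumₗ l + Y ys + (X ys + P ys)) (map-cong (f₁₂ x y) ys) ⟩
    sumₗ (map (λ z → f (y , x , z)) ys) + Y ys + (X ys + P ys) ≡⟨ expand y x ys ⟨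
    sumₗ (map f (triples (y ∷ x ∷ ys)))              ∎
    where
    open ≡-Reasoning
    XY X Y P : List A → ℕ
    XY zs = sumₗ (map (λ z → f (x , y , z)) zs)
    X zs = sumₗ (map (λ q → f (x , q)) (pairs zs))
    Y zs = sumₗ (map (λ q → f (y , q)) (pairs zs))
    P zs = sumₗ (map f (triples zs))
    expand : ∀ x y zs → sumₗ (map f (triples (x ∷ y ∷ zs))) ≡
             sumₗ (map (λ z → f (x , y , z)) zs) + sumₗ (map (λ q → f (x , q)) (pairs zs)) +
             (sumₗ (map (λ q → f (y , q)) (pairs zs)) + P zs)
    expand x y zs = trans (sum-triples-∷ f x (y ∷ zs))
      (cong₂ _+_ (sum-pairs-∷ (λ q → f (x , q)) y zs) (sum-triples-∷ f y zs))
  sum-triples-↭ f f₁₂ f₂₃ (↭.trans p q) = trans (sum-triples-↭ f f₁₂ f₂₃ p) (sum-triples-↭ f f₁₂ f₂₃ q)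

  split : ∀ (f : A → Bool) xs → ∃₂ λ ys zs →
          xs ↭ ys ++ zs × All (λ y → f y ≡ true) ys × All (λ z → f z ≡ false) zs
  split f []       = [] , [] , ↭.refl , [] , []
  split f (x ∷ xs) with split f xs | f x in eq
  ... | ys , zs , p , ps , qs | true  = x ∷ ys , zs , prep x p , eq ∷ ps , qs
  ... | ys , zs , p , ps , qs | false = ys , x ∷ zs , ↭.trans (prep x p) (↭-sym (shift x ys zs)) , ps , eq ∷ qs

  -- This brings the first row into the threshold form that `orientFirst` assumes.
  lookup-++ : ∀ (f : A → Bool) {ys zs} → All (λ y → f y ≡ true) ys → All (λ z → f z ≡ false) zs →
              ∀ i → f (lookup (ys ++ zs) i) ≡ (toℕ i <ᵇ length ys)
  lookup-++ f []       (q ∷ qs) zero    = q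
  lookup-++ f []       (q ∷ qs) (suc i) = lookup-++ f [] qs i
  lookup-++ f (p ∷ ps) qs       zero    = p
  lookup-++ f (p ∷ ps) qs       (suc i) = lookup-++ f ps qs i

  lookup-injective : ∀ {xs : List A} → Unique xs → ∀ {i j} → lookup xs i ≡ lookup xs j → i ≡ j
  lookup-injective (x ∷ u) {zero}  {zero}  eq = refl
  lookup-injective (x ∷ u) {zero}  {suc j} eq = ⊥-elim (All.lookup x (∈-lookup j) eq)
  lookup-injective (x ∷ u) {suc i} {zero}  eq = ⊥-elim (All.lookup x (∈-lookup i) (sym eq))
  lookup-injective (x ∷ u) {suc i} {suc j} eq = cong suc (lookup-injective u eq)

  Unique-resp-↭ : ∀ {xs ys : List A} → xs ↭ ys → Unique xs → Unique ys
  Unique-resp-↭ p = AllPairs-resp-↭ (setoid A) (_∘ sym) ((λ { refl → id }) , (λ { refl → id })) (↭⇒↭ₛ p)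

Within : ∀ {n} → List (Fin n) → Edge n → Set
Within us (u , v) = u ∈ us × v ∈ us

module _ {n : ℕ} (T : Tournament n) where

  sevenPacking-listed : ∀ v ws → length ws ≡ 6 → Unique (v ∷ ws) →
    ∀ k → k ≤ 6 → (∀ i → arc T v (lookup ws i) ≡ (toℕ i <ᵇ k)) →
    ∃[ m ] Packing T (Within (v ∷ ws)) m × 12 + sumₗ (map (transitivityₜ T) (triples (v ∷ ws))) ≤ 7 * m
  -- With the six entries exposed, the bound for the restricted tournament on `Fin 7` reduces to the
  -- bound for the listed vertices.
  sevenPacking-listed v ws@(_ ∷ _ ∷ _ ∷ _ ∷ _ ∷ _ ∷ []) refl unique k k≤6 row =
    let m , p , le = sevenPacking-sorted (restrict (lookup (v ∷ ws)) (lookup-injective unique) T) k k≤6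
                       (λ { 0 _ → row zero
                          ; 1 _ → row (suc zero)
                          ; 2 _ → row (suc (suc zero))
                          ; 3 _ → row (suc (suc (suc zero)))
                          ; 4 _ → row (suc (suc (suc (suc zero))))
                          ; 5 _ → row (suc (suc (suc (suc (suc zero)))))
                          ; (suc (suc (suc (suc (suc (suc _)))))) (s≤s (s≤s (s≤s (s≤s (s≤s (s≤s ())))))) })
    in m , weaken (λ { ((x , y) , _ , refl) → ∈-lookup {xs = v ∷ ws} x , ∈-lookup {xs = v ∷ ws} y }) (transport (lookup (v ∷ ws)) (lookup-injective unique) p) , le

  opaque
    -- The head of the list serves as vertex 0; its out-neighbours are moved before its
    -- in-neighbours, which gives one of the seven checked rows.
    sevenPacking : ∀ us → length us ≡ 7 → Unique us →
      ∃[ m ] Packing T (Within us) m × 12 + sumₗ (map (transitivityₜ T) (triples us)) ≤ 7 * m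
    sevenPacking (v ∷ ws) size unique = conclude (split (arc T v) ws)
      where
      conclude : (∃₂ λ ys zs → ws ↭ ys ++ zs ×
                  All (λ w → arc T v w ≡ true) ys × All (λ w → arc T v w ≡ false) zs) →
                 ∃[ m ] Packing T (Within (v ∷ ws)) m ×
                        12 + sumₗ (map (transitivityₜ T) (triples (v ∷ ws))) ≤ 7 * m
      conclude (ys , zs , p , outs , ins) =
        let size′ = trans (sym (↭-length p)) (suc-injective size)
            m , q , le = sevenPacking-listed v (ys ++ zs) size′ (Unique-resp-↭ (prep v p) unique) (length ys)
              (subst (length ys ≤_) (trans (sym (length-++ ys)) size′) (m≤m+n _ _)) (lookup-++ (arc T v) outs ins)
        in m , weaken (λ (a , b) → ∈-resp-↭ (↭-sym (prep v p)) a , ∈-resp-↭ (↭-sym (prep v p)) b) q ,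
           subst (λ s → 12 + s ≤ 7 * m) (sym (sum-triples-↭ (transitivityₜ T)
             (transitivity-swap₁₂ T) (transitivity-swap₂₃ T) (prep v p))) le

-- Transversal designs

-- Two blocks may share a vertex u, and then `Within` holds of (u , u) for both. Excluding loops
-- makes the regions of distinct blocks disjoint.
proper : ∀ {n} {T : Tournament n} {E m} → Packing T E m → Packing T (λ e → E e × proj₁ e ≢ proj₂ e) m
proper {T = T} (packing ts d@(tts , _) i s) = packing ts d (All.zip (i , loopfree tts)) s
  where
  arc⇒≢ : ∀ {x y} → arc T x y ≡ true → x ≢ y
  arc⇒≢ {x} xy refl with () ← trans (sym xy) (loopless T x)
  loopfree : ∀ {ts} → All (IsTT3 T) ts → All (λ e → proj₁ e ≢ proj₂ e) (concatMap edgesOf ts)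
  loopfree []                   = []
  loopfree ((xy , xz , yz) ∷ a) = arc⇒≢ xy ∷ arc⇒≢ xz ∷ arc⇒≢ yz ∷ loopfree a

sumₗ-cong : ∀ {A : Set} {f h : A → ℕ} {l} → All (λ x → f x ≡ h x) l → sumₗ (map f l) ≡ sumₗ (map h l)
sumₗ-cong []       = refl
sumₗ-cong (e ∷ es) = cong₂ _+_ e (sumₗ-cong es)

*-distribˡ-sumₗ : ∀ {A : Set} a (f : A → ℕ) l → a * sumₗ (map f l) ≡ sumₗ (map (λ x → a * f x) l)
*-distribˡ-sumₗ a f []      = *-zeroʳ a
*-distribˡ-sumₗ a f (x ∷ l) = trans (*-distribˡ-+ a (f x) _) (cong (a * f x +_) (*-distribˡ-sumₗ a f l))

sumMaps-sumₗ : ∀ k {s} {A : Set} (F : A → (Fin k → Fin s) → ℕ) l →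
  sumMaps k (λ f → sumₗ (map (λ x → F x f) l)) ≡ sumₗ (map (λ x → sumMaps k (F x)) l)
sumMaps-sumₗ k {s} F []      = trans (sumMaps-const k s 0) (*-zeroʳ (s ^ k))
sumMaps-sumₗ k F (x ∷ l) = trans (sumMaps-+ k (F x) _) (cong (sumMaps k (F x) +_) (sumMaps-sumₗ k F l))

opaque
  indexTriples : List (Triple 7)
  indexTriples = triples (allFin 7)

  indexTriples-distinct : All Distinct indexTriples
  indexTriples-distinct = toWitness {a? = All.all? distinct? indexTriples} tt

  length-indexTriples : length indexTriples ≡ 35
  length-indexTriples = refl

  sum-triples-tabulate : ∀ {A : Set} (h : A × A × A → ℕ) (f : Fin 7 → A) →
    sumₗ (map h (triples (tabulate f))) ≡ sumₗ (map (λ (i , j , k) → h (f i , f j , f k)) indexTriples)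
  sum-triples-tabulate h f = refl

-- Congruence is expressed by adding multiples of n to both sides, which avoids negative numbers
-- throughout the argument on slopes.
toℕ-congruent : ∀ {n} .{{_ : NonZero n}} {a b : Fin n} k l → toℕ a + k * n ≡ toℕ b + l * n → a ≡ b
toℕ-congruent {n} {a} {b} k l eq = toℕ-injective (begin
  toℕ a               ≡⟨ m<n⇒m%n≡m (toℕ<n a) ⟨
  toℕ a % n           ≡⟨ [m+kn]%n≡m%n (toℕ a) k n ⟨
  (toℕ a + k * n) % n ≡⟨ cong (_% n) eq ⟩
  (toℕ b + l * n) % n ≡⟨ [m+kn]%n≡m%n (toℕ b) l n ⟩
  toℕ b % n           ≡⟨ m<n⇒m%n≡m (toℕ<n b) ⟩
  toℕ b               ∎)
  where open ≡-Reasoning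

mod-congruent : ∀ x y n .{{_ : NonZero n}} → x mod n ≡ y mod n → x + (y / n) * n ≡ y + (x / n) * n
mod-congruent x y n eq = begin
  x + (y / n) * n                         ≡⟨ cong (_+ (y / n) * n) (m≡m%n+[m/n]*n x n) ⟩
  x % n + (x / n) * n + (y / n) * n       ≡⟨ cong (λ r → r + (x / n) * n + (y / n) * n) (mod-injective n eq) ⟩
  y % n + (x / n) * n + (y / n) * n       ≡⟨ xy∙z≈xz∙y (y % n) ((x / n) * n) ((y / n) * n) ⟩
  y % n + (y / n) * n + (x / n) * n       ≡⟨ cong (_+ (x / n) * n) (m≡m%n+[m/n]*n y n) ⟨
  y + (x / n) * n                         ∎
  where
  open ≡-Reasoning

-- 60 is the least common multiple of 1, ..., 6, the possible differences of two class indices.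
divides60 : ∀ d → 1 ≤ d → d ≤ 6 → ∃[ e ] e * d ≡ 60
divides60 1 _ _ = 60 , refl
divides60 2 _ _ = 30 , refl
divides60 3 _ _ = 20 , refl
divides60 4 _ _ = 15 , refl
divides60 5 _ _ = 12 , refl
divides60 6 _ _ = 10 , refl
divides60 (suc (suc (suc (suc (suc (suc (suc d))))))) _ (s≤s (s≤s (s≤s (s≤s (s≤s (s≤s ()))))))

module _ (g : ℕ) .{{_ : NonZero g}} where

  position : (Fin 7 → Fin g) → Fin g → Fin g → Fin 7 → Fin g
  position c a b i = (toℕ a + toℕ i * toℕ b + toℕ (c i)) mod g

module _ (t : ℕ) where

  private
    g : ℕ
    g = suc (60 * t)

    -- The values at i and i + d determine d (b - b′) modulo g, and d divides 60, which is -1/t modulo g.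
    slope : ∀ {b b′ : Fin g} i d a a′ q q′ r r′ → 1 ≤ d → d ≤ 6 →
            a + i * toℕ b + q * g ≡ a′ + i * toℕ b′ + q′ * g →
            a + (i + d) * toℕ b + r * g ≡ a′ + (i + d) * toℕ b′ + r′ * g → b ≡ b′
    slope {b} {b′} i d a a′ q q′ r r′ 1≤d d≤6 eqᵢ eqⱼ =
      -- Since y g = y + 60 t y, adding y g to x produces x + y and a multiple of 60 y = e d y.
      -- `difference` exchanges d y for d x up to multiples of g, and the remaining x + y is
      -- symmetric.
      toℕ-congruent (y + t * (e * B)) (x + t * (e * A)) (begin
        x + (y + t * (e * B)) * g           ≡⟨ collect t e x y B ⟩
        x + y + t * (60 * y + e * (B * g))  ≡⟨ cong (λ s → x + y + t * s) (factor y B) ⟩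
        x + y + t * (e * (d * y + B * g))   ≡⟨ cong (λ s → x + y + t * (e * s)) difference ⟨
        x + y + t * (e * (d * x + A * g))   ≡⟨ cong (λ s → x + y + t * s) (factor x A) ⟨
        x + y + t * (60 * x + e * (A * g))  ≡⟨ cong (_+ t * (60 * x + e * (A * g))) (+-comm x y) ⟩
        y + x + t * (60 * x + e * (A * g))  ≡⟨ collect t e y x A ⟨
        y + (x + t * (e * A)) * g           ∎)
      where
      open ≡-Reasoning
      x = toℕ b
      y = toℕ b′
      A = r + q′
      B = r′ + q
      e = proj₁ (divides60 d 1≤d d≤6)
      collect : ∀ t e x y B → x + (y + t * (e * B)) * suc (60 * t) ≡
                              x + y + t * (60 * y + e * (B * suc (60 * t)))
      collect = solve-∀
      distribute : ∀ e d y z → e * d * y + e * z ≡ e * (d * y + z)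
      distribute = solve-∀
      factor : ∀ y B → 60 * y + e * (B * g) ≡ e * (d * y + B * g)
      factor y B = subst (λ s → s * y + e * (B * g) ≡ e * (d * y + B * g))
                         (proj₂ (divides60 d 1≤d d≤6)) (distribute e d y (B * g))
      regroup : ∀ i d a a′ x y p p′ → (a + a′ + i * x + i * y) + (d * x + (p + p′)) ≡
                                       (a + (i + d) * x + p) + (a′ + i * y + p′)
      regroup = solve-∀
      difference : d * x + A * g ≡ d * y + B * g
      difference = +-cancelˡ-≡ (a + a′ + i * x + i * y) _ _ (begin
        (a + a′ + i * x + i * y) + (d * x + A * g)
          ≡⟨ cong (λ s → a + a′ + i * x + i * y + (d * x + s)) (*-distribʳ-+ g r q′) ⟩
        (a + a′ + i * x + i * y) + (d * x + (r * g + q′ * g))  ≡⟨ regroup i d a a′ x y (r * g) (q′ * g) ⟩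
        (a + (i + d) * x + r * g) + (a′ + i * y + q′ * g)      ≡⟨ cong₂ _+_ eqⱼ (sym eqᵢ) ⟩
        (a′ + (i + d) * y + r′ * g) + (a + i * x + q * g)      ≡⟨ regroup i d a′ a y x (r′ * g) (q * g) ⟨
        (a′ + a + i * y + i * x) + (d * y + (r′ * g + q * g))
          ≡⟨ cong₂ (λ u v → u + (d * y + v)) (reorder a a′ (i * x) (i * y)) (sym (*-distribʳ-+ g r′ q)) ⟩
        (a + a′ + i * x + i * y) + (d * y + B * g)             ∎)
        where
        reorder : ∀ a b c d → b + a + d + c ≡ a + b + c + d
        reorder = solve-∀

    congruent : ∀ c {a a′ b b′} i → position g c a b i ≡ position g c a′ b′ i →
                ∃₂ λ q q′ → toℕ a + toℕ i * toℕ b + q * g ≡ toℕ a′ + toℕ i * toℕ b′ + q′ * g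
    congruent c {a} {a′} {b} {b′} i eq = q , q′ , +-cancelʳ-≡ (toℕ (c i)) _ _
      (trans (xy∙z≈xz∙y u (q * g) (toℕ (c i)))
        (trans (mod-congruent (u + toℕ (c i)) (u′ + toℕ (c i)) g eq) (xy∙z≈xz∙y u′ (toℕ (c i)) (q′ * g))))
      where
      u  = toℕ a + toℕ i * toℕ b
      u′ = toℕ a′ + toℕ i * toℕ b′
      q  = (u′ + toℕ (c i)) / g
      q′ = (u + toℕ (c i)) / g

    position-slope : ∀ c {a a′ b b′ i j} → toℕ i < toℕ j → position g c a b i ≡ position g c a′ b′ i →
                     position g c a b j ≡ position g c a′ b′ j → b ≡ b′
    position-slope c {a} {a′} {b} {b′} {i} {j} i<j eqᵢ eqⱼ
      with d , i+d≡j ← m≤n⇒∃[o]m+o≡n (<⇒≤ i<j)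
      with q , q′ , eᵢ ← congruent c {a} {a′} {b} {b′} i eqᵢ
      with r , r′ , eⱼ ← congruent c {a} {a′} {b} {b′} j eqⱼ =
      slope (toℕ i) d (toℕ a) (toℕ a′) q q′ r r′
        (+-cancelˡ-≤ (toℕ i) _ _ (≤-trans (≤-reflexive (+-comm (toℕ i) 1)) (≤-trans i<j (≤-reflexive (sym i+d≡j)))))
        (≤-trans (m≤n+m d (toℕ i)) (≤-trans (≤-reflexive i+d≡j) (≤-pred (toℕ<n j))))
        eᵢ (subst (λ s → toℕ a + s * toℕ b + r * g ≡ toℕ a′ + s * toℕ b′ + r′ * g) (sym i+d≡j) eⱼ)

  position-injective′ : ∀ c {a a′ b b′ i j} → i ≢ j → position g c a b i ≡ position g c a′ b′ i →
                       position g c a b j ≡ position g c a′ b′ j → a ≡ a′ × b ≡ b′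
  position-injective′ c {a} {a′} {b} {b′} {i} {j} i≢j eqᵢ eqⱼ = intercept , b≡b′
    where
    b≡b′ : b ≡ b′
    b≡b′ with <-cmp (toℕ i) (toℕ j)
    ... | tri< i<j _ _ = position-slope c {a} {a′} i<j eqᵢ eqⱼ
    ... | tri≈ _ i≡j _ = ⊥-elim (i≢j (toℕ-injective i≡j))
    ... | tri> _ _ j<i = position-slope c {a} {a′} j<i eqⱼ eqᵢ
    intercept : a ≡ a′
    intercept with q , q′ , eᵢ ← congruent c {a} {a′} {b} {b′} i eqᵢ =
      toℕ-congruent q q′ (+-cancelʳ-≡ (toℕ i * toℕ b) _ _
        (trans (xy∙z≈xz∙y (toℕ a) (q * g) _) (trans eᵢ
          (trans (cong (λ s → toℕ a′ + toℕ i * toℕ s + q′ * g) (sym b≡b′)) (xy∙z≈xz∙y (toℕ a′) (toℕ i * toℕ b) _)))))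

position-injective : ∀ g .{{_ : NonZero g}} t → g ≡ suc (60 * t) → ∀ c {a a′ b b′ i j} → i ≢ j →
                     position g c a b i ≡ position g c a′ b′ i → position g c a b j ≡ position g c a′ b′ j →
                     a ≡ a′ × b ≡ b′
position-injective g t refl = position-injective′ t

module _ {n : ℕ} (T : Tournament n) (g : ℕ) .{{_ : NonZero g}} where

  crossing : (Fin 7 → Fin g → Fin n) → ℕ
  crossing φ = sumₗ (map (λ (i , j , k) → ∑³ (λ x y z → transitivity T (φ i x) (φ j y) (φ k z))) indexTriples)

  Crossing : (Fin 7 → Fin g → Fin n) → Edge n → Set
  Crossing φ e = ∃₂ λ i j → ∃₂ λ x y → i ≢ j × e ≡ (φ i x , φ j y)

  module _ (t : ℕ) (g≡ : g ≡ suc (60 * t)) (φ : Fin 7 → Fin g → Fin n)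
           (φ-inj : ∀ {i j x y} → φ i x ≡ φ j y → i ≡ j × x ≡ y) where

    private
      block : (Fin 7 → Fin g) → Fin g → Fin g → Fin 7 → Fin n
      block c a b i = φ i (position g c a b i)

      blockTransitivity : (Fin 7 → Fin g) → Fin g → Fin g → ℕ
      blockTransitivity c a b = sumₗ (map (λ (i , j , k) →
        transitivity T (block c a b i) (block c a b j) (block c a b k)) indexTriples)

      blocksTransitivity : (Fin 7 → Fin g) → ℕ
      blocksTransitivity c = ∑[ a < g ] ∑[ b < g ] blockTransitivity c a b

      -- For fixed a and b, independent uniform shifts put the three points of a block independently
      -- and uniformly into their classes; `offset` only translates a class.
      average-triple : ∀ a b {s} → Distinct s → let i , j , k = s in
        g * (g * g) * sumMaps 7 (λ c → transitivity T (block c a b i) (block c a b j) (block c a b k)) ≡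
        g ^ 7 * ∑³ (λ x y z → transitivity T (φ i x) (φ j y) (φ k z))
      average-triple a b {i , j , k} (i≢j , i≢k , j≢k) = trans
        (sumMaps-marginal₃ 7 g i≢j i≢k j≢k (λ x y z → transitivity T (φ i (translate i x)) (φ j (translate j y)) (φ k (translate k z))))
        (cong (g ^ 7 *_) (trans
          (sum-shift g (λ x → ∑[ y < g ] ∑[ z < g ] transitivity T (φ i x) (φ j (translate j y)) (φ k (translate k z))) (offset i))
          (sum-cong-≗ {g} λ x → trans
            (sum-shift g (λ y → ∑[ z < g ] transitivity T (φ i x) (φ j y) (φ k (translate k z))) (offset j))
            (sum-cong-≗ {g} λ y → sum-shift g (λ z → transitivity T (φ i x) (φ j y) (φ k z)) (offset k)))))
        where
        offset : Fin 7 → ℕ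
        offset l = toℕ a + toℕ l * toℕ b
        translate : Fin 7 → Fin g → Fin g
        translate l x = (offset l + toℕ x) mod g

      average-block : ∀ a b → g * (g * g) * sumMaps 7 (λ c → blockTransitivity c a b) ≡ g ^ 7 * crossing φ
      average-block a b = begin
        g * (g * g) * sumMaps 7 (λ c → blockTransitivity c a b)
          ≡⟨ cong (g * (g * g) *_) (sumMaps-sumₗ 7 (λ (i , j , k) c → transitivity T (block c a b i) (block c a b j) (block c a b k)) indexTriples) ⟩
        g * (g * g) * sumₗ (map average indexTriples)
          ≡⟨ *-distribˡ-sumₗ (g * (g * g)) average indexTriples ⟩
        sumₗ (map (λ s → g * (g * g) * average s) indexTriples)
          ≡⟨ sumₗ-cong (All.map (average-triple a b) indexTriples-distinct) ⟩
        sumₗ (map (λ s → g ^ 7 * all s) indexTriples)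
          ≡⟨ *-distribˡ-sumₗ (g ^ 7) all indexTriples ⟨
        g ^ 7 * crossing φ ∎
        where
        open ≡-Reasoning
        average all : Triple 7 → ℕ
        average (i , j , k) = sumMaps 7 (λ c → transitivity T (block c a b i) (block c a b j) (block c a b k))
        all (i , j , k) = ∑³ (λ x y z → transitivity T (φ i x) (φ j y) (φ k z))

      -- There are g² blocks, each with mean `crossing φ` / g³, so the mean of the total is
      -- `crossing φ` / g.
      average-total : g * sumMaps 7 blocksTransitivity ≡ g ^ 7 * crossing φ
      average-total = *-cancelˡ-≡ _ _ g (*-cancelˡ-≡ _ _ g (begin
        g * (g * (g * sumMaps 7 blocksTransitivity))
          ≡⟨ assoc g (sumMaps 7 blocksTransitivity) ⟩
        g * (g * g) * sumMaps 7 blocksTransitivity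
          ≡⟨ cong (g * (g * g) *_) (trans (sumMaps-sum 7 g (λ a c → ∑[ b < g ] blockTransitivity c a b))
                                           (sum-cong-≗ {g} λ a → sumMaps-sum 7 g (λ b c → blockTransitivity c a b))) ⟩
        g * (g * g) * ∑[ a < g ] ∑[ b < g ] sumMaps 7 (λ c → blockTransitivity c a b)
          ≡⟨ trans (*-distribˡ-sum {g} (g * (g * g)) _) (sum-cong-≗ {g} λ a → *-distribˡ-sum {g} (g * (g * g)) _) ⟩
        ∑[ a < g ] ∑[ b < g ] (g * (g * g) * sumMaps 7 (λ c → blockTransitivity c a b))
          ≡⟨ sum-cong-≗ {g} (λ a → sum-cong-≗ {g} (average-block a)) ⟩
        ∑[ a < g ] ∑[ b < g ] (g ^ 7 * crossing φ)
          ≡⟨ trans (sum-cong-≗ {g} λ _ → sum-const g _) (sum-const g _) ⟩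
        g * (g * (g ^ 7 * crossing φ)) ∎))
        where
        open ≡-Reasoning
        assoc : ∀ g s → g * (g * (g * s)) ≡ g * (g * g) * s
        assoc = solve-∀

      opaque
        goodShift : ∃[ c ] crossing φ ≤ g * blocksTransitivity c
        goodShift = sumMaps-pigeonhole 7 g (crossing φ) (λ c → g * blocksTransitivity c)
          (≤-reflexive (trans (sym average-total) (sumMaps-* 7 g blocksTransitivity)))

      c : Fin 7 → Fin g
      c = proj₁ goodShift

      block-injective : ∀ a b {i j} → block c a b i ≡ block c a b j → i ≡ j
      block-injective a b eq = proj₁ (φ-inj eq)

      InBlock : Fin g → Fin g → Edge n → Set
      InBlock a b e = Within (tabulate (block c a b)) e × proj₁ e ≢ proj₂ e

      blockPacking : ∀ a b → ∃[ m ] Packing T (InBlock a b) m × 12 + blockTransitivity c a b ≤ 7 * m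
      blockPacking a b =
        let m , p , le = sevenPacking T (tabulate (block c a b)) (length-tabulate (block c a b))
                           (Unique.tabulate⁺ (block-injective a b))
        in m , proper p , subst (λ s → 12 + s ≤ 7 * m) (sum-triples-tabulate (transitivityₜ T) (block c a b)) le

      indices : ∀ {a b e} → InBlock a b e → ∃₂ λ i j → i ≢ j × e ≡ (block c a b i , block c a b j)
      indices {a} {b} {e} ((u∈ , v∈) , u≢v) =
        let i , u≡ = ∈-tabulate⁻ {f = block c a b} u∈
            j , v≡ = ∈-tabulate⁻ {f = block c a b} v∈
        in i , j , (λ i≡j → u≢v (trans u≡ (trans (cong (block c a b) i≡j) (sym v≡)))) , cong₂ _,_ u≡ v≡

      blocks-disjoint : ∀ {a b a′ b′ e} → InBlock a b e → InBlock a′ b′ e → a ≡ a′ × b ≡ b′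
      blocks-disjoint {a} {b} {a′} {b′} p q with indices p | indices q
      ... | i , j , i≢j , refl | i′ , j′ , _ , eq with φ-inj (cong proj₁ eq) | φ-inj (cong proj₂ eq)
      ...   | refl , eqᵢ | refl , eqⱼ = position-injective g t g≡ c i≢j eqᵢ eqⱼ

      size : Fin g → Fin g → ℕ
      size a b = proj₁ (blockPacking a b)

      size-bound : g * (g * 12) + blocksTransitivity c ≤ 7 * ∑[ a < g ] ∑[ b < g ] size a b
      size-bound = begin
        g * (g * 12) + blocksTransitivity c
          ≡⟨ cong (_+ blocksTransitivity c) (trans (sum-cong-≗ {g} λ _ → sum-const g 12) (sum-const g (g * 12))) ⟨
        ∑[ a < g ] ∑[ b < g ] 12 + blocksTransitivity c
          ≡⟨ trans (sum-cong-≗ {g} λ a → ∑-distrib-+ {g} _ _) (∑-distrib-+ {g} _ _) ⟨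
        ∑[ a < g ] ∑[ b < g ] (12 + blockTransitivity c a b)
          ≤⟨ sum-mono {g} (λ a → sum-mono {g} (λ b → proj₂ (proj₂ (blockPacking a b)))) ⟩
        ∑[ a < g ] ∑[ b < g ] (7 * size a b)
          ≡⟨ trans (*-distribˡ-sum {g} 7 _) (sum-cong-≗ {g} λ a → *-distribˡ-sum {g} 7 _) ⟨
        7 * ∑[ a < g ] ∑[ b < g ] size a b ∎
        where open ≤-Reasoning

    transversalPacking : ∃[ m ] Packing T (Crossing φ) m × 12 * (g * (g * g)) + crossing φ ≤ 7 * g * m
    transversalPacking = _ , weaken inside (⋃ g (λ (_ , p) (_ , q) → proj₁ (blocks-disjoint p q))
      (λ a → ⋃ g (λ p q → proj₂ (blocks-disjoint p q)) (λ b → proj₁ (proj₂ (blockPacking a b))))) , bound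
      where
      inside : ∀ {e} → (∃₂ λ a b → InBlock a b e) → Crossing φ e
      inside (a , b , p) = let i , j , i≢j , eq = indices p in i , j , _ , _ , i≢j , eq
      open ≤-Reasoning
      e₁ : ∀ g s → 12 * (g * (g * g)) + g * s ≡ g * (g * (g * 12) + s)
      e₁ = solve-∀
      e₂ : ∀ g s → g * (7 * s) ≡ 7 * g * s
      e₂ = solve-∀
      bound = begin
        12 * (g * (g * g)) + crossing φ           ≤⟨ +-monoʳ-≤ (12 * (g * (g * g))) (proj₂ goodShift) ⟩
        12 * (g * (g * g)) + g * blocksTransitivity c          ≡⟨ e₁ g (blocksTransitivity c) ⟩
        g * (g * (g * 12) + blocksTransitivity c)              ≤⟨ *-monoʳ-≤ g size-bound ⟩
        g * (7 * ∑[ a < g ] ∑[ b < g ] size a b)  ≡⟨ e₂ g _ ⟩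
        7 * g * ∑[ a < g ] ∑[ b < g ] size a b    ∎

-- Averaging over partitions into seven classes

sumₗ-const : ∀ {A : Set} a (l : List A) → sumₗ (map (λ _ → a) l) ≡ length l * a
sumₗ-const a []      = refl
sumₗ-const a (_ ∷ l) = cong (a +_) (sumₗ-const a l)

sumₗ-mono : ∀ {A : Set} {f h : A → ℕ} → (∀ x → f x ≤ h x) → ∀ l → sumₗ (map f l) ≤ sumₗ (map h l)
sumₗ-mono f≤h []      = z≤n
sumₗ-mono f≤h (x ∷ l) = +-mono-≤ (f≤h x) (sumₗ-mono f≤h l)

opaque
  -- Rotations are independent only for distinct fibres, so the average over partitions is
  -- restricted to triples of vertices from three different fibres.
  distinctness : ∀ {n} → Fin n → Fin n → Fin n → ℕ
  distinctness x y z = indicator (does (distinct? (x , y , z)))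

  distinctness-cases : ∀ {n} (x y z : Fin n) →
    distinctness x y z ≡ 0 ⊎ (distinctness x y z ≡ 1 × Distinct (x , y , z))
  distinctness-cases x y z = cases (distinct? (x , y , z))
    where
    cases : ∀ {P : Set} (d : Dec P) → indicator (does d) ≡ 0 ⊎ (indicator (does d) ≡ 1 × P)
    cases (yes p) = inj₂ (refl , p)
    cases (no  _) = inj₁ refl

  distinctness+δ : ∀ {n} (x y z : Fin n) → 1 ≤ distinctness x y z + (δ x y + δ x z + δ y z)
  distinctness+δ x y z with x Fin.≟ y | x Fin.≟ z | y Fin.≟ z
  ... | yes refl | _        | _        = ≤-trans (≤-reflexive (sym (δ-diagonal x))) (≤-trans (m≤m+n _ _) (m≤m+n _ _))
  ... | no _     | yes refl | _        = ≤-trans (≤-reflexive (sym (δ-diagonal x))) (≤-trans (m≤n+m (δ x x) (δ x y)) (m≤m+n _ (δ y x)))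
  ... | no _     | no _     | yes refl = ≤-trans (≤-reflexive (sym (δ-diagonal y))) (m≤n+m _ _)
  ... | no _     | no _     | no _     = s≤s z≤n

distinctness≤1 : ∀ {n} (x y z : Fin n) a → distinctness x y z * a ≤ a
distinctness≤1 x y z a with distinctness x y z | distinctness-cases x y z
... | _ | inj₁ refl       = z≤n
... | _ | inj₂ (refl , _) = ≤-reflexive (*-identityˡ a)

module _ (g : ℕ) .{{_ : NonZero g}} (T : Tournament (g * 7)) where

  -- The vertices are grouped into g fibres of 7; this sums over three fixed fibres.
  fibres : Fin g → Fin g → Fin g → ℕ
  fibres x y z = ∑³ {7} (λ p q s → transitivity T (combine x p) (combine y q) (combine z s))

  fibresSum : ℕ
  fibresSum = ∑³ (λ x y z → distinctness x y z * fibres x y z)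

  -- A random partition whose classes have exactly g vertices: every fibre sends one vertex to each
  -- class, according to its own rotation.
  rotatedClass : (Fin g → Fin 7) → Fin 7 → Fin g → Fin (g * 7)
  rotatedClass r i x = combine x ((toℕ i + toℕ (r x)) mod 7)

  rotatedClass-injective : ∀ r {i j x y} → rotatedClass r i x ≡ rotatedClass r j y → i ≡ j × x ≡ y
  rotatedClass-injective r {i} {j} {x} {y} eq with combine-injectiveˡ x _ y _ eq
  ... | refl = toℕ-congruent ((toℕ j + s) / 7) ((toℕ i + s) / 7) (+-cancelʳ-≡ s _ _
                 (trans (xy∙z≈xz∙y (toℕ i) _ s) (trans
                   (mod-congruent (toℕ i + s) (toℕ j + s) 7 (combine-injectiveʳ x _ x _ eq))
                   (xy∙z≈xz∙y (toℕ j) s _)))) , refl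
    where
    s = toℕ (r x)

  private
    rotated : Triple 7 → Fin g → Fin g → Fin g → (Fin g → Fin 7) → ℕ
    rotated (i , j , k) x y z r =
      distinctness x y z * transitivity T (rotatedClass r i x) (rotatedClass r j y) (rotatedClass r k z)

    -- Three distinct fibres have independent rotations, with 343 = 7³ joint values; if two fibres
    -- coincide, both sides vanish.
    average-rotated : ∀ t x y z → 343 * sumMaps g (rotated t x y z) ≡ 7 ^ g * (distinctness x y z * fibres x y z)
    average-rotated (i , j , k) x y z with distinctness x y z | distinctness-cases x y z
    ... | _ | inj₁ refl = trans (cong (343 *_) (trans (sumMaps-const g 7 0) (*-zeroʳ (7 ^ g)))) (sym (*-zeroʳ (7 ^ g)))
    ... | _ | inj₂ (refl , x≢y , x≢z , y≢z) = begin
      343 * sumMaps g (λ r → 1 * tr (r x) (r y) (r z))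
        ≡⟨ cong (343 *_) (sumMaps-cong g (λ r → *-identityˡ (tr (r x) (r y) (r z)))) ⟩
      343 * sumMaps g (λ r → tr (r x) (r y) (r z))
        ≡⟨ sumMaps-marginal₃ g 7 x≢y x≢z y≢z tr ⟩
      7 ^ g * ∑³ tr
        ≡⟨ cong (7 ^ g *_) (trans
             (sum-shift 7 (λ p → ∑[ q < 7 ] ∑[ s < 7 ] transitivity T (combine x p) (combine y (translate j q)) (combine z (translate k s))) (toℕ i))
             (sum-cong-≗ {7} λ p → trans
               (sum-shift 7 (λ q → ∑[ s < 7 ] transitivity T (combine x p) (combine y q) (combine z (translate k s))) (toℕ j))
               (sum-cong-≗ {7} λ q → sum-shift 7 (λ s → transitivity T (combine x p) (combine y q) (combine z s)) (toℕ k)))) ⟩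
      7 ^ g * fibres x y z
        ≡⟨ cong (7 ^ g *_) (sym (*-identityˡ (fibres x y z))) ⟩
      7 ^ g * (1 * fibres x y z) ∎
      where
      open ≡-Reasoning
      translate : Fin 7 → Fin 7 → Fin 7
      translate l p = (toℕ l + toℕ p) mod 7
      tr : Fin 7 → Fin 7 → Fin 7 → ℕ
      tr p q s = transitivity T (combine x (translate i p)) (combine y (translate j q)) (combine z (translate k s))

    crossingDistinct : (Fin g → Fin 7) → ℕ
    crossingDistinct r = sumₗ (map (λ t → ∑³ (λ x y z → rotated t x y z r)) indexTriples)

    average-crossing : 343 * sumMaps g crossingDistinct ≡ 7 ^ g * (35 * fibresSum)
    average-crossing = begin
      343 * sumMaps g crossingDistinct
        ≡⟨ cong (343 *_) (sumMaps-sumₗ g (λ t r → ∑³ (λ x y z → rotated t x y z r)) indexTriples) ⟩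
      343 * sumₗ (map (λ t → sumMaps g (λ r → ∑³ (λ x y z → rotated t x y z r))) indexTriples)
        ≡⟨ *-distribˡ-sumₗ 343 (λ t → sumMaps g (λ r → ∑³ (λ x y z → rotated t x y z r))) indexTriples ⟩
      sumₗ (map (λ t → 343 * sumMaps g (λ r → ∑³ (λ x y z → rotated t x y z r))) indexTriples)
        ≡⟨ sumₗ-cong (All.universal each indexTriples) ⟩
      sumₗ (map (λ _ → 7 ^ g * fibresSum) indexTriples)
        ≡⟨ trans (sumₗ-const _ indexTriples) (cong (_* (7 ^ g * fibresSum)) length-indexTriples) ⟩
      35 * (7 ^ g * fibresSum)
        ≡⟨ swap₁₂ 35 (7 ^ g) fibresSum ⟩
      7 ^ g * (35 * fibresSum) ∎
      where
      open ≡-Reasoning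
      swap₁₂ : ∀ a b c → a * (b * c) ≡ b * (a * c)
      swap₁₂ = solve-∀
      each : ∀ t → 343 * sumMaps g (λ r → ∑³ (λ x y z → rotated t x y z r)) ≡ 7 ^ g * fibresSum
      each t = begin
        343 * sumMaps g (λ r → ∑³ (λ x y z → rotated t x y z r))
          ≡⟨ cong (343 *_) (trans (sumMaps-sum g g (λ x r → ∑[ y < g ] ∑[ z < g ] rotated t x y z r))
               (sum-cong-≗ {g} λ x → trans (sumMaps-sum g g (λ y r → ∑[ z < g ] rotated t x y z r))
                 (sum-cong-≗ {g} λ y → sumMaps-sum g g (rotated t x y)))) ⟩
        343 * ∑³ (λ x y z → sumMaps g (rotated t x y z))
          ≡⟨ *-distribˡ-∑³ {g} 343 (λ x y z → sumMaps g (rotated t x y z)) ⟩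
        ∑³ (λ x y z → 343 * sumMaps g (rotated t x y z))
          ≡⟨ ∑³-cong {g} (average-rotated t) ⟩
        ∑³ (λ x y z → 7 ^ g * (distinctness x y z * fibres x y z))
          ≡⟨ *-distribˡ-∑³ {g} (7 ^ g) (λ x y z → distinctness x y z * fibres x y z) ⟨
        7 ^ g * fibresSum ∎

  opaque
    goodRotation : ∃[ r ] 35 * fibresSum ≤ 343 * crossing T g (rotatedClass r)
    goodRotation =
      let r , le = sumMaps-pigeonhole g 7 (35 * fibresSum) (λ r → 343 * crossingDistinct r)
                     (≤-reflexive (trans (sym average-crossing) (sumMaps-* g 343 crossingDistinct)))
      in r , ≤-trans le (*-monoʳ-≤ 343 (sumₗ-mono (λ t → sum-mono {g} λ x → sum-mono {g} λ y → sum-mono {g} λ z →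
               distinctness≤1 x y z _) indexTriples))

∑³-combine : ∀ m n (f : Fin (m * n) → Fin (m * n) → Fin (m * n) → ℕ) →
  ∑³ f ≡ ∑³ {m} (λ x y z → ∑³ {n} (λ p q s → f (combine x p) (combine y q) (combine z s)))
∑³-combine m n f = begin
  ∑³ f
    ≡⟨ trans (sum-combine m n _) (sum-cong-≗ {m} λ x → sum-cong-≗ {n} λ p →
         trans (sum-combine m n _) (sum-cong-≗ {m} λ y → sum-cong-≗ {n} λ q → sum-combine m n _)) ⟩
  ∑[ x < m ] ∑[ p < n ] ∑[ y < m ] ∑[ q < n ] ∑[ z < m ] ∑[ s < n ] f′ x p y q z s
    ≡⟨ sum-cong-≗ {m} (λ x → ∑-comm {n} {m} (λ p y → ∑[ q < n ] ∑[ z < m ] ∑[ s < n ] f′ x p y q z s)) ⟩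
  ∑[ x < m ] ∑[ y < m ] ∑[ p < n ] ∑[ q < n ] ∑[ z < m ] ∑[ s < n ] f′ x p y q z s
    ≡⟨ sum-cong-≗ {m} (λ x → sum-cong-≗ {m} λ y → sum-cong-≗ {n} λ p → ∑-comm {n} {m} (λ q z → ∑[ s < n ] f′ x p y q z s)) ⟩
  ∑[ x < m ] ∑[ y < m ] ∑[ p < n ] ∑[ z < m ] ∑[ q < n ] ∑[ s < n ] f′ x p y q z s
    ≡⟨ sum-cong-≗ {m} (λ x → sum-cong-≗ {m} λ y → ∑-comm {n} {m} (λ p z → ∑[ q < n ] ∑[ s < n ] f′ x p y q z s)) ⟩
  ∑[ x < m ] ∑[ y < m ] ∑[ z < m ] ∑[ p < n ] ∑[ q < n ] ∑[ s < n ] f′ x p y q z s ∎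
  where
  open ≡-Reasoning
  f′ : Fin m → Fin n → Fin m → Fin n → Fin m → Fin n → ℕ
  f′ x p y q z s = f (combine x p) (combine y q) (combine z s)

∑³-δ : ∀ n → ∑³ {n} (λ x y z → δ x y + δ x z + δ y z) ≡ 3 * (n * n)
∑³-δ n = begin
  ∑³ {n} (λ x y z → δ x y + δ x z + δ y z)
    ≡⟨ trans (∑³-+ {n} (λ x y z → δ x y + δ x z) (λ x y z → δ y z))
             (cong (_+ ∑³ {n} (λ x y z → δ y z)) (∑³-+ {n} (λ x y z → δ x y) (λ x y z → δ x z))) ⟩
  ∑³ {n} (λ x y z → δ x y) + ∑³ {n} (λ x y z → δ x z) + ∑³ {n} (λ x y z → δ y z)
    ≡⟨ cong₂ _+_ (cong₂ _+_ first (trans (sum-cong-≗ {n} λ x → ones {n} (λ _ → sum-δ x)) (sum-const n n)))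
                 (trans (sum-cong-≗ {n} λ x → ones {n} sum-δ) (sum-const n n)) ⟩
  n * n + n * n + n * n
    ≡⟨ three (n * n) ⟩
  3 * (n * n) ∎
  where
  open ≡-Reasoning
  three : ∀ a → a + a + a ≡ 3 * a
  three = solve-∀
  ones : ∀ {m} {f : Fin m → ℕ} → (∀ i → f i ≡ 1) → sum f ≡ m
  ones {m} e = trans (sum-cong-≗ {m} e) (trans (sum-const m 1) (*-identityʳ m))
  first : ∑³ {n} (λ x y z → δ x y) ≡ n * n
  first = trans (sum-cong-≗ {n} λ x → trans (sum-cong-≗ {n} λ y → sum-const n (δ x y))
    (trans (sym (*-distribˡ-sum {n} n (δ x))) (trans (cong (n *_) (sum-δ x)) (*-identityʳ n)))) (sum-const n n)

module _ (g : ℕ) .{{_ : NonZero g}} (T : Tournament (g * 7)) where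

  private
    fibres≤ : ∀ x y z → fibres g T x y z ≤ 1029
    fibres≤ x y z = ∑³-mono {7} (λ p q s → transitivity≤3 T (combine x p) (combine y q) (combine z s))

    -- At most 3 g² triples of fibres contain a coincidence, and each accounts for at most 3 · 7³ =
    -- 1029, whence 3087.
    fibresSum≥ : ∑³ (transitivity T) ≤ fibresSum g T + 3087 * (g * g)
    fibresSum≥ = begin
      ∑³ (transitivity T)
        ≡⟨ ∑³-combine g 7 (transitivity T) ⟩
      ∑³ (fibres g T)
        ≤⟨ ∑³-mono {g} pointwise ⟩
      ∑³ {g} (λ x y z → distinctness x y z * fibres g T x y z + 1029 * (δ x y + δ x z + δ y z))
        ≡⟨ ∑³-+ {g} (λ x y z → distinctness x y z * fibres g T x y z) (λ x y z → 1029 * (δ x y + δ x z + δ y z)) ⟩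
      fibresSum g T + ∑³ {g} (λ x y z → 1029 * (δ x y + δ x z + δ y z))
        ≡⟨ cong (fibresSum g T +_) (trans (sym (*-distribˡ-∑³ {g} 1029 (λ x y z → δ x y + δ x z + δ y z)))
             (trans (cong (1029 *_) (∑³-δ g)) (sym (*-assoc 1029 3 (g * g))))) ⟩
      fibresSum g T + 3087 * (g * g) ∎
      where
      open ≤-Reasoning
      pointwise : ∀ x y z → fibres g T x y z ≤
                  distinctness x y z * fibres g T x y z + 1029 * (δ x y + δ x z + δ y z)
      pointwise x y z = begin
        F                        ≡⟨ *-identityˡ F ⟨
        1 * F                    ≤⟨ *-monoˡ-≤ F (distinctness+δ x y z) ⟩
        (d + e) * F              ≡⟨ *-distribʳ-+ F d e ⟩
        d * F + e * F            ≤⟨ +-monoʳ-≤ (d * F) (*-monoʳ-≤ e (fibres≤ x y z)) ⟩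
        d * F + e * 1029         ≡⟨ cong (d * F +_) (*-comm e 1029) ⟩
        d * F + 1029 * e         ∎
        where
        F = fibres g T x y z
        d = distinctness x y z
        e = δ x y + δ x z + δ y z

  -- To leading order `fibresSum` is at least 3/4 · 343 g³, so X is at least 105/4 · g³, and 12 +
  -- 105/4 = 153/4 gives 153 g² ≤ 28 M. The quadratic errors add up to 5 (4 · 3087 + 6 · 49) g² =
  -- 63210 g² = 49 · 1290 g². The term 20 Q is added on both sides so that Q can be eliminated
  -- without subtraction.
  crossingBound : ∀ X M → 35 * fibresSum g T ≤ 343 * X → 12 * (g * (g * g)) + X ≤ 7 * g * M →
                  153 * (g * g) ≤ 28 * M + 1290 * g
  crossingBound X M Q≤X X≤M = *-cancelˡ-≤ (49 * g) (+-cancelʳ-≤ (20 * Q) _ _ (begin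
    49 * g * (153 * (g * g)) + 20 * Q
      ≡⟨ e₁ g Q ⟩
    2352 * (g * (g * g)) + 5 * (3 * (g * 7 * (g * 7 * (g * 7)))) + 20 * Q
      ≤⟨ +-monoˡ-≤ (20 * Q) (+-monoʳ-≤ (2352 * (g * (g * g))) (*-monoʳ-≤ 5 (≤-trans (sum-transitivity≥ T)
           (+-monoˡ-≤ (6 * (g * 7 * (g * 7))) (*-monoʳ-≤ 4 fibresSum≥))))) ⟩
    2352 * (g * (g * g)) + 5 * (4 * (Q + 3087 * (g * g)) + 6 * (g * 7 * (g * 7))) + 20 * Q
      ≡⟨ e₂ g Q ⟩
    2352 * (g * (g * g)) + 4 * (5 * Q) + (63210 * (g * g) + 20 * Q)
      ≤⟨ +-monoˡ-≤ (63210 * (g * g) + 20 * Q) (+-monoʳ-≤ (2352 * (g * (g * g))) (*-monoʳ-≤ 4 5Q≤49X)) ⟩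
    2352 * (g * (g * g)) + 4 * (49 * X) + (63210 * (g * g) + 20 * Q)
      ≡⟨ e₃ g X Q ⟩
    196 * (12 * (g * (g * g)) + X) + (63210 * (g * g) + 20 * Q)
      ≤⟨ +-monoˡ-≤ (63210 * (g * g) + 20 * Q) (*-monoʳ-≤ 196 X≤M) ⟩
    196 * (7 * g * M) + (63210 * (g * g) + 20 * Q)
      ≡⟨ e₄ g M Q ⟩
    49 * g * (28 * M + 1290 * g) + 20 * Q ∎))
    where
    open ≤-Reasoning
    Q = fibresSum g T
    instance
      49g≢0 : NonZero (49 * g)
      49g≢0 = m*n≢0 49 g
    5Q≤49X : 5 * Q ≤ 49 * X
    5Q≤49X = *-cancelˡ-≤ 7 (subst₂ _≤_ (*-assoc 7 5 Q) (*-assoc 7 49 X) Q≤X)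
    e₁ : ∀ g Q → 49 * g * (153 * (g * g)) + 20 * Q ≡
                 2352 * (g * (g * g)) + 5 * (3 * (g * 7 * (g * 7 * (g * 7)))) + 20 * Q
    e₁ = solve-∀
    e₂ : ∀ g Q → 2352 * (g * (g * g)) + 5 * (4 * (Q + 3087 * (g * g)) + 6 * (g * 7 * (g * 7))) + 20 * Q ≡
                 2352 * (g * (g * g)) + 4 * (5 * Q) + (63210 * (g * g) + 20 * Q)
    e₂ = solve-∀
    e₃ : ∀ g X Q → 2352 * (g * (g * g)) + 4 * (49 * X) + (63210 * (g * g) + 20 * Q) ≡
                   196 * (12 * (g * (g * g)) + X) + (63210 * (g * g) + 20 * Q)
    e₃ = solve-∀
    e₄ : ∀ g M Q → 196 * (7 * g * M) + (63210 * (g * g) + 20 * Q) ≡ 49 * g * (28 * M + 1290 * g) + 20 * Q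
    e₄ = solve-∀

-- The recursion

HasPacking : ∀ {n} → Tournament n → ℕ → Set
HasPacking T m = Packing T (λ _ → ⊤) m

addClasses : ∀ {n g} .{{_ : NonZero g}} (T : Tournament n) (φ : Fin 7 → Fin g → Fin n)
             (φ-inj : ∀ {i j x y} → φ i x ≡ φ j y → i ≡ j × x ≡ y) {M} (s : Fin 7 → ℕ) →
             Packing T (Crossing T g φ) M → (∀ i → HasPacking (restrict (φ i) (proj₂ ∘ φ-inj) T) (s i)) →
             HasPacking T (M + sum s)
addClasses {n} {g} T φ φ-inj s across inside = weaken (λ _ → tt)
  (union apart across (⋃ 7 same (λ i → transport (φ i) (proj₂ ∘ φ-inj) (inside i))))
  where
  InClass : Fin 7 → Edge n → Set
  InClass i e = ∃[ (x , y) ] ⊤ × e ≡ (φ i x , φ i y)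
  same : ∀ {i j e} → InClass i e → InClass j e → i ≡ j
  same (_ , _ , refl) (_ , _ , eq) = proj₁ (φ-inj (cong proj₁ eq))
  apart : ∀ {e} → Crossing T g φ e → (∃[ i ] InClass i e) → ⊥
  apart (i , j , x , y , i≢j , refl) (k , _ , _ , eq) =
    i≢j (trans (proj₁ (φ-inj (cong proj₁ eq))) (sym (proj₁ (φ-inj (cong proj₂ eq)))))

-- 17848 = 100 · 153 + 28 · 7 · 13 exceeds 28 · 13 · 7² by 12; this surplus pays for the linear terms.
step : ∀ g .{{_ : NonZero g}} t → g ≡ suc (60 * t) → (T : Tournament (g * 7)) (C : ℕ) →
       (∀ (H : Tournament g) → ∃[ m ] HasPacking H m × 13 * (g * g) ≤ 100 * m + C * g) →
       ∃[ m ] HasPacking T m × 17848 * (g * g) ≤ 2800 * m + 129000 * g + 196 * (C * g)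
step g t g≡ T C ih =
  M + sum s , addClasses T φ (λ {i} {j} → φ-inj {i} {j}) s (proj₁ (proj₂ transversal)) (λ i → proj₁ (proj₂ (ih (class i)))) , bound
  where
  r = proj₁ (goodRotation g T)
  φ = rotatedClass g T r
  φ-inj : ∀ {i j x y} → φ i x ≡ φ j y → i ≡ j × x ≡ y
  φ-inj {i} {j} = rotatedClass-injective g T r {i} {j}
  transversal = transversalPacking T g t g≡ φ (λ {i} {j} → φ-inj {i} {j})
  M = proj₁ transversal
  class : ∀ i → Tournament g
  class i = restrict (φ i) (proj₂ ∘ φ-inj {i} {i}) T
  s : Fin 7 → ℕ
  s i = proj₁ (ih (class i))
  bound = begin
    17848 * (g * g)
      ≡⟨ e₁ (g * g) ⟩
    100 * (153 * (g * g)) + 28 * (7 * (13 * (g * g)))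
      ≤⟨ +-mono-≤ (*-monoʳ-≤ 100 (crossingBound g T _ M (proj₂ (goodRotation g T)) (proj₂ (proj₂ transversal))))
                  (*-monoʳ-≤ 28 (begin
                    7 * (13 * (g * g))               ≡⟨ sum-const 7 (13 * (g * g)) ⟨
                    ∑[ _ < 7 ] (13 * (g * g))        ≤⟨ sum-mono {7} (λ i → proj₂ (proj₂ (ih (class i)))) ⟩
                    ∑[ i < 7 ] (100 * s i + C * g)   ≡⟨ ∑-distrib-+ {7} (λ i → 100 * s i) (λ _ → C * g) ⟩
                    ∑[ i < 7 ] (100 * s i) + ∑[ _ < 7 ] (C * g)
                      ≡⟨ cong₂ _+_ (sym (*-distribˡ-sum {7} 100 s)) (sum-const 7 (C * g)) ⟩
                    100 * sum s + 7 * (C * g)        ∎)) ⟩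
    100 * (28 * M + 1290 * g) + 28 * (100 * sum s + 7 * (C * g))
      ≡⟨ e₂ M (sum s) g (C * g) ⟩
    2800 * (M + sum s) + 129000 * g + 196 * (C * g) ∎
    where
    open ≤-Reasoning
    e₁ : ∀ a → 17848 * a ≡ 100 * (153 * a) + 28 * (7 * (13 * a))
    e₁ = solve-∀
    e₂ : ∀ M S g c → 100 * (28 * M + 1290 * g) + 28 * (100 * S + 7 * c) ≡
                     2800 * (M + S) + 129000 * g + 196 * c
    e₂ = solve-∀

-- Since 196 C g = 28 · C · 7 g, the recursive error passes from the classes to n with the same C.
-- All new linear terms together are (129000 + 5096 · 419 + 364) g = 2264588 g, which 12 g² covers
-- because g ≥ 200000; the part in r² is below 364 g as 419² ≤ 200000.
grow : ∀ C g r m → 200000 ≤ g → r ≤ 419 → 17848 * (g * g) ≤ 2800 * m + 129000 * g + 196 * (C * g) →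
       13 * ((g * 7 + r) * (g * 7 + r)) ≤ 100 * m + C * (g * 7 + r)
grow C g r m g≥ r≤ le = *-cancelˡ-≤ 28 (+-cancelʳ-≤ (12 * (g * g)) _ _ (begin
  28 * (13 * ((g * 7 + r) * (g * 7 + r))) + 12 * (g * g)
    ≡⟨ e₁ g r ⟩
  17848 * (g * g) + (5096 * g * r + 364 * (r * r))
    ≤⟨ +-mono-≤ le (+-mono-≤ (*-monoʳ-≤ (5096 * g) r≤) (*-monoʳ-≤ 364 (*-mono-≤ r≤ r≤))) ⟩
  2800 * m + 129000 * g + 196 * (C * g) + (5096 * g * 419 + 364 * (419 * 419))
    ≤⟨ +-monoʳ-≤ (2800 * m + 129000 * g + 196 * (C * g)) (+-monoʳ-≤ (5096 * g * 419) (*-monoʳ-≤ 364 (≤-trans 419²≤200000 g≥))) ⟩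
  2800 * m + 129000 * g + 196 * (C * g) + (5096 * g * 419 + 364 * g)
    ≡⟨ e₂ m g (C * g) ⟩
  2800 * m + 196 * (C * g) + 2264588 * g
    ≤⟨ +-monoʳ-≤ (2800 * m + 196 * (C * g)) (≤-trans (*-monoˡ-≤ g 2264588≤12*200000) (≤-trans (*-monoˡ-≤ g (*-monoʳ-≤ 12 g≥)) (≤-reflexive (*-assoc 12 g g)))) ⟩
  2800 * m + 196 * (C * g) + 12 * (g * g)
    ≤⟨ +-monoˡ-≤ (12 * (g * g)) (m≤m+n (2800 * m + 196 * (C * g)) (28 * (C * r))) ⟩
  2800 * m + 196 * (C * g) + 28 * (C * r) + 12 * (g * g)
    ≡⟨ cong (_+ 12 * (g * g)) (e₃ m g r C) ⟩
  28 * (100 * m + C * (g * 7 + r)) + 12 * (g * g) ∎))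
  where
  open ≤-Reasoning
  419²≤200000 : 419 * 419 ≤ 200000
  419²≤200000 = ≤ᵇ⇒≤ (419 * 419) 200000 tt
  2264588≤12*200000 : 2264588 ≤ 12 * 200000
  2264588≤12*200000 = ≤ᵇ⇒≤ 2264588 (12 * 200000) tt
  e₁ : ∀ g r → 28 * (13 * ((g * 7 + r) * (g * 7 + r))) + 12 * (g * g) ≡
               17848 * (g * g) + (5096 * g * r + 364 * (r * r))
  e₁ = solve-∀
  e₂ : ∀ m g c → 2800 * m + 129000 * g + 196 * c + (5096 * g * 419 + 364 * g) ≡ 2800 * m + 196 * c + 2264588 * g
  e₂ = solve-∀
  e₃ : ∀ m g r C → 2800 * m + 196 * (C * g) + 28 * (C * r) ≡ 28 * (100 * m + C * (g * 7 + r))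
  e₃ = solve-∀

-- Beyond 1400420 = 7 · 200000 + 420 the class size g is at least 200000; below it, C ≥ 13 · 1400420
-- makes the bound trivial.
linear : ∀ C → 18205460 ≤ C → ∀ n → Acc _<_ n → (T : Tournament n) →
         ∃[ m ] HasPacking T m × 13 * (n * n) ≤ 100 * m + C * n
linear C C≥ n (acc rec) T with n ≤? 1400420
... | yes n≤ = 0 , emptyPacking , (begin
  13 * (n * n)       ≡⟨ *-assoc 13 n n ⟨
  13 * n * n         ≤⟨ *-monoˡ-≤ n (≤-trans (*-monoʳ-≤ 13 n≤) C≥) ⟩
  C * n              ∎)
  where open ≤-Reasoning
... | no  n≰ = m , weaken (λ _ → tt) (transport ι ι-inj (proj₁ (proj₂ packed))) , bound
  where
  n> : 1400420 < n
  n> = ≰⇒> n≰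
  -- 420 = 7 · 60: removing 7 before dividing leaves n = 7 (60 t + 1) + r with r ≤ 419, and the r
  -- last vertices are dropped.
  t = (n ∸ 7) / 420
  r = (n ∸ 7) % 420
  g = suc (60 * t)
  regroup : ∀ t r → 7 + (r + t * 420) ≡ suc (60 * t) * 7 + r
  regroup = solve-∀
  n≡ : n ≡ g * 7 + r
  n≡ = trans (sym (m+[n∸m]≡n (≤-trans (≤ᵇ⇒≤ 7 1400420 tt) (<⇒≤ n>))))
         (trans (cong (7 +_) (m≡m%n+[m/n]*n (n ∸ 7) 420)) (regroup t r))
  r≤ : r ≤ 419
  r≤ = ≤-pred (m%n<n (n ∸ 7) 420)
  g≥ : 200000 ≤ g
  g≥ = *-cancelʳ-≤ 200000 g 7 (+-cancelʳ-≤ 419 _ _ (begin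
    1400000 + 419 ≤⟨ ≤ᵇ⇒≤ 1400419 1400420 tt ⟩
    1400420       ≤⟨ <⇒≤ n> ⟩
    n             ≡⟨ n≡ ⟩
    g * 7 + r     ≤⟨ +-monoʳ-≤ (g * 7) r≤ ⟩
    g * 7 + 419   ∎))
    where open ≤-Reasoning
  g7≤n : g * 7 ≤ n
  g7≤n = ≤-trans (m≤m+n (g * 7) r) (≤-reflexive (sym n≡))
  g<n : g < n
  g<n = ≤-trans (m<m*n g 7 (s≤s (s≤s z≤n))) g7≤n
  ι : Fin (g * 7) → Fin n
  ι x = inject≤ x g7≤n
  ι-inj : ∀ {x y} → ι x ≡ ι y → x ≡ y
  ι-inj = Fin.inject≤-injective g7≤n g7≤n _ _
  packed = step g t refl (restrict ι ι-inj T) C (linear C C≥ g (rec g<n))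
  m = proj₁ packed
  bound : 13 * (n * n) ≤ 100 * m + C * n
  bound = subst (λ n → 13 * (n * n) ≤ 100 * m + C * n) (sym n≡) (grow C g r m g≥ r≤ (proj₂ (proj₂ packed)))

theorem1p2 : ∀ (k : ℕ) → ∃[ N ] ∀ (n : ℕ) → N ≤ n → (T : Tournament n) →
    ∃[ ts ] (EdgeDisjointTT3s T ts ×
    (13 * suc k ∸ 100) * (n * n) ≤ 100 * suc k * length ts)
-- With s = `suc k` the claim is m ≥ (0.13 - 1 / s) n², trivial by truncation for s ≤ 7; letting s
-- grow gives the asymptotic bound. From n ≥ C s on, the error C s n is at most n², well within the
-- allowance of 100 n².
theorem1p2 k = 18205460 * suc k , λ n n≥N T →
  let m , packing ts disjoint _ size , le = linear 18205460 ≤-refl n (<-wellFounded n) T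
  in ts , disjoint , subst (λ m → (13 * suc k ∸ 100) * (n * n) ≤ 100 * suc k * m) (sym size) (conclude 18205460 (suc k) n m n≥N le)
  where
  open ≤-Reasoning
  e₁ : ∀ s a → 13 * s * a ≡ s * (13 * a)
  e₁ = solve-∀
  e₂ : ∀ s m C n → s * (100 * m + C * n) ≡ C * s * n + 100 * s * m
  e₂ = solve-∀
  conclude : ∀ C s n m → C * s ≤ n → 13 * (n * n) ≤ 100 * m + C * n →
             (13 * s ∸ 100) * (n * n) ≤ 100 * s * m
  conclude C s n m Cs≤n le = begin
    (13 * s ∸ 100) * (n * n)            ≡⟨ *-distribʳ-∸ (n * n) (13 * s) 100 ⟩
    13 * s * (n * n) ∸ 100 * (n * n)    ≤⟨ m≤n+o⇒m∸n≤o (13 * s * (n * n)) (100 * (n * n)) (begin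
      13 * s * (n * n)                  ≡⟨ e₁ s (n * n) ⟩
      s * (13 * (n * n))                ≤⟨ *-monoʳ-≤ s le ⟩
      s * (100 * m + C * n)             ≡⟨ e₂ s m C n ⟩
      C * s * n + 100 * s * m           ≤⟨ +-monoˡ-≤ (100 * s * m) (*-monoˡ-≤ n Cs≤n) ⟩
      n * n + 100 * s * m               ≤⟨ +-monoˡ-≤ (100 * s * m) (m≤n*m (n * n) 100) ⟩
      100 * (n * n) + 100 * s * m       ∎) ⟩
    100 * s * m ∎
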